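{- There is an absolute constant $C>0$ such that for every integer $d\geq 3$ there exists $n_0>0$ such that for every $n\geq n_0$ there is a graph $G$ on $2n$ vertices with $\sigma_2(\tilde A_G)\leq C/\sqrt d$ (i.e. $G$ is an $O(1/\sqrt d)$-spectral expander) which has no perfect matching.
   Context: For a graph $G$ on $2n$ vertices without isolated vertices, with adjacency matrix $A$ and diagonal degree matrix $D$, the normalized adjacency matrix is $\tilde A_G=D^{ -1/2}AD^{ -1/2}$, with eigenvalues $\lambda_1\geq\dots\geq\lambda_{2n}$; set $\sigma_2(\tilde A_G)=\max\{\lambda_2,|\lambda_{2n}|\}$. $G$ is an $\epsilon$-spectral expander if $\sigma_2(\tilde A_G)\leq\epsilon$. The graph $G$ here need not be regular. -}

module Defs where

open import Data.Bool using (Bool; false; T; if_then_else_)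
open import Data.Fin using (Fin; fromℕ<)
import Data.Fin as Fin
import Data.Fin.Properties as Fin
open import Data.Fin.Subset using (Subset; ∣_∣)
open import Data.Integer using (+_; +[1+_])
import Data.Integer as ℤ
import Data.Integer.Properties as ℤ
import Data.Integer.Solver as ℤ
open import Data.Nat using (ℕ; zero; suc; z≤n; s≤s; NonZero)
import Data.Nat as ℕ
import Data.Nat.Properties as ℕ
import Data.Nat.Solver as ℕ
open import Data.Product using (Σ; Σ-syntax; ∃!; _×_; _,_; proj₁; proj₂)
open import Data.Rational using (ℚ; mkℚ; 0ℚ; 1ℚ; ½)
import Data.Rational as ℚ
import Data.Rational.Properties as ℚ
import Data.Rational.Solver as ℚ
open import Data.Rational.Unnormalised using (mkℚᵘ)
import Data.Rational.Unnormalised as ℚᵘ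
import Data.Rational.Unnormalised.Properties as ℚᵘ
open import Data.Sum using (inj₁; inj₂)
open import Data.Vec using (tabulate)
open import Data.Vec.Functional using (Vector; foldr)
open import Relation.Binary.PropositionalEquality using (_≡_; refl; sym; trans; cong; cong₂; subst; subst₂)
open import Relation.Nullary using (yes; no; does)

------------------------------------------------------------------------
-- Real numbers: Cauchy sequences of rationals with a modulus, up to _≃ℝ_.

Cauchy : (ℕ → ℚ) → Set
Cauchy x = ∀ ε → 0ℚ ℚ.< ε →
  Σ[ N ∈ ℕ ] (∀ m n → N ℕ.≤ m → N ℕ.≤ n → ℚ.∣ x m ℚ.- x n ∣ ℚ.≤ ε)

record ℝ : Set where
  constructor mkℝ
  field
    seq    : ℕ → ℚ
    cauchy : Cauchy seq

open ℝ public

infix 4 _≃ℝ_ _≤ℝ_ _<ℝ_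

_≃ℝ_ : ℝ → ℝ → Set
x ≃ℝ y = ∀ ε → 0ℚ ℚ.< ε →
  Σ[ N ∈ ℕ ] (∀ n → N ℕ.≤ n → ℚ.∣ seq x n ℚ.- seq y n ∣ ℚ.≤ ε)

_≤ℝ_ : ℝ → ℝ → Set
x ≤ℝ y = ∀ ε → 0ℚ ℚ.< ε →
  Σ[ N ∈ ℕ ] (∀ n → N ℕ.≤ n → seq x n ℚ.≤ seq y n ℚ.+ ε)

_<ℝ_ : ℝ → ℝ → Set
x <ℝ y = Σ[ ε ∈ ℚ ] 0ℚ ℚ.< ε ×
  (Σ[ N ∈ ℕ ] (∀ n → N ℕ.≤ n → seq x n ℚ.+ ε ℚ.≤ seq y n))

private
  open ℚ.+-*-Solver using (solve; _:=_; _:+_; _:*_; :-_; _:-_; con)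
  open ℚ.≤-Reasoning

  dist : ℚ → ℚ → ℚ
  dist p q = ℚ.∣ p ℚ.- q ∣

  p≤∣p∣ : ∀ p → p ℚ.≤ ℚ.∣ p ∣
  p≤∣p∣ p with ℚ.≤-total 0ℚ p
  ... | inj₁ 0≤p = ℚ.≤-reflexive (sym (ℚ.0≤p⇒∣p∣≡p 0≤p))
  ... | inj₂ p≤0 = ℚ.≤-trans p≤0 (ℚ.0≤∣p∣ p)

  dist-sym : ∀ p q → dist p q ≡ dist q p
  dist-sym p q = trans (sym (ℚ.∣-p∣≡∣p∣ (p ℚ.- q)))
    (cong ℚ.∣_∣ (solve 2 (λ p q → :- (p :- q) := q :- p) refl p q))

  ≤-dist : ∀ p q → p ℚ.≤ q ℚ.+ dist p q
  ≤-dist p q = begin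
    p                 ≡⟨ solve 2 (λ p q → p := q :+ (p :- q)) refl p q ⟩
    q ℚ.+ (p ℚ.- q)   ≤⟨ ℚ.+-monoʳ-≤ q (p≤∣p∣ (p ℚ.- q)) ⟩
    q ℚ.+ dist p q    ∎

  dist-≤ : ∀ {p q r} → p ℚ.≤ q ℚ.+ r → q ℚ.≤ p ℚ.+ r → dist p q ℚ.≤ r
  dist-≤ {p} {q} {r} p≤ q≤ with ℚ.∣p∣≡p∨∣p∣≡-p (p ℚ.- q)
  ... | inj₁ eq = begin
    dist p q           ≡⟨ eq ⟩
    p ℚ.- q            ≤⟨ ℚ.+-monoˡ-≤ (ℚ.- q) p≤ ⟩
    q ℚ.+ r ℚ.- q      ≡⟨ solve 2 (λ q r → q :+ r :- q := r) refl q r ⟩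
    r                  ∎
  ... | inj₂ eq = begin
    dist p q           ≡⟨ eq ⟩
    ℚ.- (p ℚ.- q)      ≡⟨ solve 2 (λ p q → :- (p :- q) := q :- p) refl p q ⟩
    q ℚ.- p            ≤⟨ ℚ.+-monoˡ-≤ (ℚ.- p) q≤ ⟩
    p ℚ.+ r ℚ.- p      ≡⟨ solve 2 (λ p r → p :+ r :- p := r) refl p r ⟩
    r                  ∎

  dist-refl : ∀ p → dist p p ≡ 0ℚ
  dist-refl p = cong ℚ.∣_∣ (ℚ.+-inverseʳ p)

  *-mono-≤ : ∀ {p q r s} → 0ℚ ℚ.≤ r → 0ℚ ℚ.≤ q → p ℚ.≤ q → r ℚ.≤ s → p ℚ.* r ℚ.≤ q ℚ.* s
  *-mono-≤ {p} {q} {r} {s} 0≤r 0≤q p≤q r≤s = ℚ.≤-trans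
    (ℚ.*-monoʳ-≤-nonNeg r {{ℚ.nonNegative 0≤r}} p≤q)
    (ℚ.*-monoˡ-≤-nonNeg q {{ℚ.nonNegative 0≤q}} r≤s)

  *-pos : ∀ {p q} → 0ℚ ℚ.< p → 0ℚ ℚ.< q → 0ℚ ℚ.< p ℚ.* q
  *-pos {p} {q} 0<p 0<q = subst (ℚ._< p ℚ.* q) (ℚ.*-zeroʳ p)
    (ℚ.*-monoʳ-<-pos p {{ℚ.positive 0<p}} 0<q)

  1/pos : ∀ {p} (0<p : 0ℚ ℚ.< p) → 0ℚ ℚ.< (ℚ.1/ p) {{ℚ.>-nonZero 0<p}}
  1/pos {p} 0<p = ℚ.positive⁻¹ _ {{ℚ.1/pos⇒pos p {{ℚ.positive 0<p}}}}

  0<½ : 0ℚ ℚ.< ½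
  0<½ = ℚ.positive⁻¹ ½

  0<1 : 0ℚ ℚ.< 1ℚ
  0<1 = ℚ.positive⁻¹ 1ℚ

  lipschitz : (x y : ℝ) (s : ℕ → ℚ) (K : ℚ) → 0ℚ ℚ.< K → (N₀ : ℕ) →
    (∀ m n → N₀ ℕ.≤ m → N₀ ℕ.≤ n →
       dist (s m) (s n) ℚ.≤ K ℚ.* (dist (seq x m) (seq x n) ℚ.+ dist (seq y m) (seq y n))) →
    Cauchy s
  lipschitz x y s K 0<K N₀ bound ε 0<ε = N , close
    where
    instance
      K≢0 : ℚ.NonZero K
      K≢0 = ℚ.>-nonZero 0<K
    δ = ε ℚ.* ½ ℚ.* ℚ.1/ K
    0<δ : 0ℚ ℚ.< δ
    0<δ = *-pos (*-pos 0<ε 0<½) (1/pos 0<K)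
    Nx = proj₁ (cauchy x δ 0<δ)
    Ny = proj₁ (cauchy y δ 0<δ)
    N = N₀ ℕ.⊔ (Nx ℕ.⊔ Ny)
    N₀≤ : N₀ ℕ.≤ N
    N₀≤ = ℕ.m≤m⊔n N₀ (Nx ℕ.⊔ Ny)
    Nx≤ : Nx ℕ.≤ N
    Nx≤ = ℕ.≤-trans (ℕ.m≤m⊔n Nx Ny) (ℕ.m≤n⊔m N₀ (Nx ℕ.⊔ Ny))
    Ny≤ : Ny ℕ.≤ N
    Ny≤ = ℕ.≤-trans (ℕ.m≤n⊔m Nx Ny) (ℕ.m≤n⊔m N₀ (Nx ℕ.⊔ Ny))
    close : ∀ m n → N ℕ.≤ m → N ℕ.≤ n → dist (s m) (s n) ℚ.≤ ε
    close m n N≤m N≤n = begin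
      dist (s m) (s n)
        ≤⟨ bound m n (ℕ.≤-trans N₀≤ N≤m) (ℕ.≤-trans N₀≤ N≤n) ⟩
      K ℚ.* (dist (seq x m) (seq x n) ℚ.+ dist (seq y m) (seq y n))
        ≤⟨ ℚ.*-monoˡ-≤-nonNeg K {{ℚ.pos⇒nonNeg K {{ℚ.positive 0<K}}}} (ℚ.+-mono-≤
             (proj₂ (cauchy x δ 0<δ) m n (ℕ.≤-trans Nx≤ N≤m) (ℕ.≤-trans Nx≤ N≤n))
             (proj₂ (cauchy y δ 0<δ) m n (ℕ.≤-trans Ny≤ N≤m) (ℕ.≤-trans Ny≤ N≤n))) ⟩
      K ℚ.* (δ ℚ.+ δ)
        ≡⟨ solve 3 (λ k e i → k :* (e :* con ½ :* i :+ e :* con ½ :* i) := e :* (k :* i)) refl K ε (ℚ.1/ K) ⟩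
      ε ℚ.* (K ℚ.* ℚ.1/ K)
        ≡⟨ cong (ε ℚ.*_) (ℚ.*-inverseʳ K) ⟩
      ε ℚ.* 1ℚ
        ≡⟨ ℚ.*-identityʳ ε ⟩
      ε ∎

  contraction : (x y : ℝ) (s : ℕ → ℚ) →
    (∀ m n → dist (s m) (s n) ℚ.≤ dist (seq x m) (seq x n) ℚ.+ dist (seq y m) (seq y n)) →
    Cauchy s
  contraction x y s bound = lipschitz x y s 1ℚ 0<1 0
    (λ m n _ _ → ℚ.≤-trans (bound m n) (ℚ.≤-reflexive (sym (ℚ.*-identityˡ _))))

  eventualBound : (x : ℝ) → Σ[ B ∈ ℚ ] 0ℚ ℚ.< B ×
    (Σ[ N ∈ ℕ ] (∀ n → N ℕ.≤ n → ℚ.∣ seq x n ∣ ℚ.≤ B))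
  eventualBound x = B , ℚ.+-mono-≤-< (ℚ.0≤∣p∣ (seq x N)) 0<1 , N , λ n N≤n → begin
      ℚ.∣ seq x n ∣
        ≡⟨ cong ℚ.∣_∣ (solve 2 (λ a b → a := b :+ (a :- b)) refl (seq x n) (seq x N)) ⟩
      ℚ.∣ seq x N ℚ.+ (seq x n ℚ.- seq x N) ∣
        ≤⟨ ℚ.∣p+q∣≤∣p∣+∣q∣ (seq x N) (seq x n ℚ.- seq x N) ⟩
      ℚ.∣ seq x N ∣ ℚ.+ dist (seq x n) (seq x N)
        ≤⟨ ℚ.+-monoʳ-≤ ℚ.∣ seq x N ∣ (proj₂ (cauchy x 1ℚ 0<1) n N N≤n ℕ.≤-refl) ⟩
      B ∎
    where
    N = proj₁ (cauchy x 1ℚ 0<1)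
    B = ℚ.∣ seq x N ∣ ℚ.+ 1ℚ

private abstract
  const-cauchy : ∀ p → Cauchy (λ _ → p)
  const-cauchy p ε 0<ε = 0 , λ _ _ _ _ →
    ℚ.≤-trans (ℚ.≤-reflexive (dist-refl p)) (ℚ.<⇒≤ 0<ε)

fromℚ : ℚ → ℝ
fromℚ p = mkℝ (λ _ → p) (const-cauchy p)

0ℝ 1ℝ : ℝ
0ℝ = fromℚ 0ℚ
1ℝ = fromℚ 1ℚ

infix  8 -ℝ_
infixl 7 _*ℝ_
infixl 6 _+ℝ_ _⊔ℝ_

private abstract
  +-cauchy : ∀ x y → Cauchy (λ n → seq x n ℚ.+ seq y n)
  +-cauchy x y = contraction x y (λ n → seq x n ℚ.+ seq y n) λ m n → begin
    dist (seq x m ℚ.+ seq y m) (seq x n ℚ.+ seq y n)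
      ≡⟨ cong ℚ.∣_∣ (solve 4 (λ a b c d → (a :+ b) :- (c :+ d) := (a :- c) :+ (b :- d)) refl
           (seq x m) (seq y m) (seq x n) (seq y n)) ⟩
    ℚ.∣ (seq x m ℚ.- seq x n) ℚ.+ (seq y m ℚ.- seq y n) ∣
      ≤⟨ ℚ.∣p+q∣≤∣p∣+∣q∣ (seq x m ℚ.- seq x n) (seq y m ℚ.- seq y n) ⟩
    dist (seq x m) (seq x n) ℚ.+ dist (seq y m) (seq y n) ∎

  neg-cauchy : ∀ x → Cauchy (λ n → ℚ.- seq x n)
  neg-cauchy x = contraction x 0ℝ (λ n → ℚ.- seq x n) λ m n → ℚ.≤-reflexive
    (trans (cong ℚ.∣_∣ (solve 2 (λ a b → :- a :- :- b := :- (a :- b)) refl (seq x m) (seq x n)))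
    (trans (ℚ.∣-p∣≡∣p∣ (seq x m ℚ.- seq x n)) (sym (ℚ.+-identityʳ _))))

  *-cauchy : ∀ x y → Cauchy (λ n → seq x n ℚ.* seq y n)
  *-cauchy x y = lipschitz x y (λ n → seq x n ℚ.* seq y n) K 0<K N₀ bound
    where
    Bx : ℚ
    Bx = proj₁ (eventualBound x)
    By : ℚ
    By = proj₁ (eventualBound y)
    0<Bx : 0ℚ ℚ.< Bx
    0<Bx = proj₁ (proj₂ (eventualBound x))
    0<By : 0ℚ ℚ.< By
    0<By = proj₁ (proj₂ (eventualBound y))
    Nx : ℕ
    Nx = proj₁ (proj₂ (proj₂ (eventualBound x)))
    Ny : ℕ
    Ny = proj₁ (proj₂ (proj₂ (eventualBound y)))
    N₀ : ℕ
    N₀ = Nx ℕ.⊔ Ny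
    K : ℚ
    K = Bx ℚ.+ By
    0<K : 0ℚ ℚ.< K
    0<K = ℚ.+-mono-< 0<Bx 0<By
    bound : ∀ m n → N₀ ℕ.≤ m → N₀ ℕ.≤ n →
      dist (seq x m ℚ.* seq y m) (seq x n ℚ.* seq y n) ℚ.≤
      K ℚ.* (dist (seq x m) (seq x n) ℚ.+ dist (seq y m) (seq y n))
    bound m n N₀≤m N₀≤n = begin
      dist (a ℚ.* b) (c ℚ.* d)
        ≡⟨ cong ℚ.∣_∣ (solve 4 (λ a b c d → a :* b :- c :* d := a :* (b :- d) :+ d :* (a :- c)) refl a b c d) ⟩
      ℚ.∣ a ℚ.* (b ℚ.- d) ℚ.+ d ℚ.* (a ℚ.- c) ∣
        ≤⟨ ℚ.∣p+q∣≤∣p∣+∣q∣ (a ℚ.* (b ℚ.- d)) (d ℚ.* (a ℚ.- c)) ⟩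
      ℚ.∣ a ℚ.* (b ℚ.- d) ∣ ℚ.+ ℚ.∣ d ℚ.* (a ℚ.- c) ∣
        ≡⟨ cong₂ ℚ._+_ (ℚ.∣p*q∣≡∣p∣*∣q∣ a (b ℚ.- d)) (ℚ.∣p*q∣≡∣p∣*∣q∣ d (a ℚ.- c)) ⟩
      ℚ.∣ a ∣ ℚ.* dist b d ℚ.+ ℚ.∣ d ∣ ℚ.* dist a c
        ≤⟨ ℚ.+-mono-≤
             (*-mono-≤ (ℚ.0≤∣p∣ (b ℚ.- d)) (ℚ.<⇒≤ 0<K) (ℚ.≤-trans ∣a∣≤ Bx≤K) ℚ.≤-refl)
             (*-mono-≤ (ℚ.0≤∣p∣ (a ℚ.- c)) (ℚ.<⇒≤ 0<K) (ℚ.≤-trans ∣d∣≤ By≤K) ℚ.≤-refl) ⟩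
      K ℚ.* dist b d ℚ.+ K ℚ.* dist a c
        ≡⟨ solve 3 (λ k u v → k :* u :+ k :* v := k :* (v :+ u)) refl K (dist b d) (dist a c) ⟩
      K ℚ.* (dist a c ℚ.+ dist b d) ∎
      where
      a : ℚ
      a = seq x m
      b : ℚ
      b = seq y m
      c : ℚ
      c = seq x n
      d : ℚ
      d = seq y n
      ∣a∣≤ : ℚ.∣ a ∣ ℚ.≤ Bx
      ∣a∣≤ = proj₂ (proj₂ (proj₂ (eventualBound x))) m (ℕ.≤-trans (ℕ.m≤m⊔n Nx Ny) N₀≤m)
      ∣d∣≤ : ℚ.∣ d ∣ ℚ.≤ By
      ∣d∣≤ = proj₂ (proj₂ (proj₂ (eventualBound y))) n (ℕ.≤-trans (ℕ.m≤n⊔m Nx Ny) N₀≤n)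
      Bx≤K : Bx ℚ.≤ K
      Bx≤K = ℚ.≤-trans (ℚ.≤-reflexive (sym (ℚ.+-identityʳ Bx))) (ℚ.+-monoʳ-≤ Bx (ℚ.<⇒≤ 0<By))
      By≤K : By ℚ.≤ K
      By≤K = ℚ.≤-trans (ℚ.≤-reflexive (sym (ℚ.+-identityˡ By))) (ℚ.+-monoˡ-≤ By (ℚ.<⇒≤ 0<Bx))

opaque
  _+ℝ_ : ℝ → ℝ → ℝ
  x +ℝ y = mkℝ (λ n → seq x n ℚ.+ seq y n) (+-cauchy x y)

  -ℝ_ : ℝ → ℝ
  -ℝ x = mkℝ (λ n → ℚ.- seq x n) (neg-cauchy x)

  _*ℝ_ : ℝ → ℝ → ℝ
  x *ℝ y = mkℝ (λ n → seq x n ℚ.* seq y n) (*-cauchy x y)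

private
  ⊔-step : ∀ a b c d → a ℚ.⊔ b ℚ.≤ (c ℚ.⊔ d) ℚ.+ (dist a c ℚ.+ dist b d)
  ⊔-step a b c d = ℚ.⊔-lub
    (begin
      a                               ≤⟨ ≤-dist a c ⟩
      c ℚ.+ dist a c                  ≤⟨ ℚ.+-mono-≤ (ℚ.p≤p⊔q c d) (u≤u+v (dist a c) (ℚ.0≤∣p∣ (b ℚ.- d))) ⟩
      (c ℚ.⊔ d) ℚ.+ (dist a c ℚ.+ dist b d) ∎)
    (begin
      b                               ≤⟨ ≤-dist b d ⟩
      d ℚ.+ dist b d                  ≤⟨ ℚ.+-mono-≤ (ℚ.p≤q⊔p c d)
                                           (ℚ.≤-trans (u≤u+v (dist b d) (ℚ.0≤∣p∣ (a ℚ.- c)))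
                                             (ℚ.≤-reflexive (ℚ.+-comm (dist b d) (dist a c)))) ⟩
      (c ℚ.⊔ d) ℚ.+ (dist a c ℚ.+ dist b d) ∎)
    where
    u≤u+v : ∀ u {v} → 0ℚ ℚ.≤ v → u ℚ.≤ u ℚ.+ v
    u≤u+v u 0≤v = ℚ.≤-trans (ℚ.≤-reflexive (sym (ℚ.+-identityʳ u))) (ℚ.+-monoʳ-≤ u 0≤v)

  ⊔-dist : ∀ a b c d → dist (a ℚ.⊔ b) (c ℚ.⊔ d) ℚ.≤ dist a c ℚ.+ dist b d
  ⊔-dist a b c d = dist-≤ (⊔-step a b c d)
    (subst₂ (λ u v → c ℚ.⊔ d ℚ.≤ (a ℚ.⊔ b) ℚ.+ (u ℚ.+ v)) (dist-sym c a) (dist-sym d b) (⊔-step c d a b))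

private abstract
  ⊔-cauchy : ∀ x y → Cauchy (λ n → seq x n ℚ.⊔ seq y n)
  ⊔-cauchy x y = contraction x y (λ n → seq x n ℚ.⊔ seq y n)
    λ m n → ⊔-dist (seq x m) (seq y m) (seq x n) (seq y n)

opaque
  _⊔ℝ_ : ℝ → ℝ → ℝ
  x ⊔ℝ y = mkℝ (λ n → seq x n ℚ.⊔ seq y n) (⊔-cauchy x y)

∣_∣ℝ : ℝ → ℝ
∣ x ∣ℝ = x ⊔ℝ (-ℝ x)

recipℚ : ∀ {e} → 0ℚ ℚ.< e → ℚ → ℚ
recipℚ {e} 0<e p = (ℚ.1/ (p ℚ.⊔ e)) {{ℚ.>-nonZero (ℚ.<-≤-trans 0<e (ℚ.p≤q⊔p p e))}}

private
  1/-dist : ∀ {e p q} (0<e : 0ℚ ℚ.< e) .{{_ : ℚ.NonZero e}} .{{_ : ℚ.NonZero p}} .{{_ : ℚ.NonZero q}} →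
    e ℚ.≤ p → e ℚ.≤ q →
    dist (ℚ.1/ p) (ℚ.1/ q) ℚ.≤ (ℚ.1/ e ℚ.* ℚ.1/ e) ℚ.* dist p q
  1/-dist {e} {p} {q} 0<e e≤p e≤q = begin
    dist (ℚ.1/ p) (ℚ.1/ q)
      ≡⟨ cong ℚ.∣_∣ eq ⟩
    ℚ.∣ (ℚ.1/ p ℚ.* ℚ.1/ q) ℚ.* (q ℚ.- p) ∣
      ≡⟨ ℚ.∣p*q∣≡∣p∣*∣q∣ (ℚ.1/ p ℚ.* ℚ.1/ q) (q ℚ.- p) ⟩
    ℚ.∣ ℚ.1/ p ℚ.* ℚ.1/ q ∣ ℚ.* dist q p
      ≡⟨ cong₂ ℚ._*_ (ℚ.0≤p⇒∣p∣≡p (ℚ.<⇒≤ (*-pos 0<1/p 0<1/q))) (dist-sym q p) ⟩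
    (ℚ.1/ p ℚ.* ℚ.1/ q) ℚ.* dist p q
      ≤⟨ *-mono-≤ (ℚ.0≤∣p∣ (p ℚ.- q)) (ℚ.<⇒≤ (*-pos 0<1/e 0<1/e))
           (*-mono-≤ (ℚ.<⇒≤ 0<1/q) (ℚ.<⇒≤ 0<1/e) (antitone e≤p 0<1/p) (antitone e≤q 0<1/q)) ℚ.≤-refl ⟩
    (ℚ.1/ e ℚ.* ℚ.1/ e) ℚ.* dist p q ∎
    where
    0<1/e : 0ℚ ℚ.< ℚ.1/ e
    0<1/e = 1/pos 0<e
    0<1/p : 0ℚ ℚ.< ℚ.1/ p
    0<1/p = 1/pos (ℚ.<-≤-trans 0<e e≤p)
    0<1/q : 0ℚ ℚ.< ℚ.1/ q
    0<1/q = 1/pos (ℚ.<-≤-trans 0<e e≤q)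
    eq : ℚ.1/ p ℚ.- ℚ.1/ q ≡ (ℚ.1/ p ℚ.* ℚ.1/ q) ℚ.* (q ℚ.- p)
    eq = sym (trans
      (solve 4 (λ i j q p → (i :* j) :* (q :- p) := i :* (j :* q) :- j :* (i :* p)) refl (ℚ.1/ p) (ℚ.1/ q) q p)
      (cong₂ ℚ._-_ (trans (cong (ℚ.1/ p ℚ.*_) (ℚ.*-inverseˡ q)) (ℚ.*-identityʳ (ℚ.1/ p)))
                   (trans (cong (ℚ.1/ q ℚ.*_) (ℚ.*-inverseˡ p)) (ℚ.*-identityʳ (ℚ.1/ q)))))
    antitone : ∀ {r} .{{_ : ℚ.NonZero r}} → e ℚ.≤ r → 0ℚ ℚ.< ℚ.1/ r → ℚ.1/ r ℚ.≤ ℚ.1/ e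
    antitone {r} e≤r 0<1/r = begin
      ℚ.1/ r                        ≡⟨ trans (cong (ℚ.1/ r ℚ.*_) (ℚ.*-inverseʳ e)) (ℚ.*-identityʳ (ℚ.1/ r)) ⟨
      ℚ.1/ r ℚ.* (e ℚ.* ℚ.1/ e)     ≤⟨ ℚ.*-monoˡ-≤-nonNeg (ℚ.1/ r) {{ℚ.nonNegative (ℚ.<⇒≤ 0<1/r)}}
                                         (ℚ.*-monoʳ-≤-nonNeg (ℚ.1/ e) {{ℚ.nonNegative (ℚ.<⇒≤ 0<1/e)}} e≤r) ⟩
      ℚ.1/ r ℚ.* (r ℚ.* ℚ.1/ e)     ≡⟨ ℚ.*-assoc (ℚ.1/ r) r (ℚ.1/ e) ⟨
      (ℚ.1/ r ℚ.* r) ℚ.* ℚ.1/ e     ≡⟨ trans (cong (ℚ._* ℚ.1/ e) (ℚ.*-inverseˡ r)) (ℚ.*-identityˡ (ℚ.1/ e)) ⟩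
      ℚ.1/ e                        ∎

private abstract
  recip-cauchy : ∀ x {e} (0<e : 0ℚ ℚ.< e) → Cauchy (λ n → recipℚ 0<e (seq x n))
  recip-cauchy x {e} 0<e =
    lipschitz x 0ℝ (λ n → recipℚ 0<e (seq x n)) (ℚ.1/ e ℚ.* ℚ.1/ e) (*-pos (1/pos 0<e) (1/pos 0<e)) 0 λ m n _ _ →
    ℚ.≤-trans
      (1/-dist {e} {seq x m ℚ.⊔ e} {seq x n ℚ.⊔ e} 0<e {{e≢0}} {{≢0 m}} {{≢0 n}} (ℚ.p≤q⊔p (seq x m) e) (ℚ.p≤q⊔p (seq x n) e))
      (ℚ.*-monoˡ-≤-nonNeg (ℚ.1/ e ℚ.* ℚ.1/ e) {{ℚ.nonNegative (ℚ.<⇒≤ (*-pos (1/pos 0<e) (1/pos 0<e)))}}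
        (ℚ.≤-trans (⊔-dist (seq x m) e (seq x n) e)
          (ℚ.+-monoʳ-≤ (dist (seq x m) (seq x n)) (ℚ.≤-reflexive (dist-refl e)))))
    where
    instance
      e≢0 : ℚ.NonZero e
      e≢0 = ℚ.>-nonZero 0<e
    ≢0 : ∀ n → ℚ.NonZero (seq x n ℚ.⊔ e)
    ≢0 n = ℚ.>-nonZero (ℚ.<-≤-trans 0<e (ℚ.p≤q⊔p (seq x n) e))

-- If e > 0 is an eventual lower bound of x, then 1/x is the limit of
-- 1 / max(xₙ, e).
opaque
  recip : (x : ℝ) → 0ℝ <ℝ x → ℝ
  recip x (e , 0<e , _) = mkℝ (λ n → recipℚ 0<e (seq x n)) (recip-cauchy x 0<e)

⌊√_⌋ : ℕ → ℕ
⌊√ zero ⌋  = 0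
⌊√ suc n ⌋ with suc ⌊√ n ⌋ ℕ.* suc ⌊√ n ⌋ ℕ.≤? suc n
... | yes _ = suc ⌊√ n ⌋
... | no  _ = ⌊√ n ⌋

⌊√⌋-lower : ∀ n → ⌊√ n ⌋ ℕ.* ⌊√ n ⌋ ℕ.≤ n
⌊√⌋-lower zero = z≤n
⌊√⌋-lower (suc n) with suc ⌊√ n ⌋ ℕ.* suc ⌊√ n ⌋ ℕ.≤? suc n
... | yes le = le
... | no  _  = ℕ.m≤n⇒m≤1+n (⌊√⌋-lower n)

⌊√⌋-upper : ∀ n → n ℕ.< suc ⌊√ n ⌋ ℕ.* suc ⌊√ n ⌋
⌊√⌋-upper zero = s≤s z≤n
⌊√⌋-upper (suc n) with suc ⌊√ n ⌋ ℕ.* suc ⌊√ n ⌋ ℕ.≤? suc n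
... | yes _  = ℕ.≤-<-trans (⌊√⌋-upper n) (ℕ.*-mono-< (ℕ.n<1+n (suc ⌊√ n ⌋)) (ℕ.n<1+n (suc ⌊√ n ⌋)))
... | no  ≰ = ℕ.≰⇒> ≰

frac : ℕ → ℕ → ℚ
frac a n = + a ℚ./ suc n

frac-≤ : ∀ {a m b n} → a ℕ.* suc n ℕ.≤ b ℕ.* suc m → frac a m ℚ.≤ frac b n
frac-≤ {a} {m} {b} {n} le = ℚ.toℚᵘ-cancel-≤ (ℚᵘ.≤-trans
  (ℚᵘ.≤-reflexive (ℚ.toℚᵘ-fromℚᵘ (mkℚᵘ (+ a) m))) (ℚᵘ.≤-trans
  (ℚᵘ.*≤* (subst₂ ℤ._≤_ (ℤ.pos-* a (suc n)) (ℤ.pos-* b (suc m)) (ℤ.+≤+ le)))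
  (ℚᵘ.≤-reflexive (ℚᵘ.≃-sym (ℚ.toℚᵘ-fromℚᵘ (mkℚᵘ (+ b) n))))))

frac-suc : ∀ a n → frac (suc a) n ≡ frac a n ℚ.+ frac 1 n
frac-suc a n = ℚ.toℚᵘ-injective (ℚᵘ.≃-trans (ℚ.toℚᵘ-fromℚᵘ (mkℚᵘ (+ suc a) n)) (ℚᵘ.≃-trans step
  (ℚᵘ.≃-sym (ℚᵘ.≃-trans (ℚ.toℚᵘ-homo-+ (frac a n) (frac 1 n))
    (ℚᵘ.+-cong (ℚ.toℚᵘ-fromℚᵘ (mkℚᵘ (+ a) n)) (ℚ.toℚᵘ-fromℚᵘ (mkℚᵘ (+ 1) n)))))))
  where
  step : mkℚᵘ (+ suc a) n ℚᵘ.≃ mkℚᵘ (+ a) n ℚᵘ.+ mkℚᵘ (+ 1) n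
  step = ℚᵘ.*≡* (S.solve 2 (λ a N → (S.con (+ 1) S.:+ a) S.:* (N S.:* N) S.:=
      (a S.:* N S.:+ S.con (+ 1) S.:* N) S.:* N) refl (+ a) (+ suc n))
    where module S = ℤ.+-*-Solver

frac-small : ∀ ε → 0ℚ ℚ.< ε → Σ[ N ∈ ℕ ] (∀ n → N ℕ.≤ n → frac 1 n ℚ.≤ ε)
frac-small (mkℚ +[1+ a ] b c) _ = b , λ n b≤n → ℚ.≤-trans
  (frac-≤ {1} {n} {suc a} {b} (ℕ.*-mono-≤ (s≤s (z≤n {a})) (s≤s b≤n)))
  (ℚ.≤-reflexive (ℚ.fromℚᵘ-toℚᵘ (mkℚ +[1+ a ] b c)))
frac-small (mkℚ (+ 0) b c) (ℚ.*<* (ℤ.+<+ ()))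
frac-small (mkℚ (ℤ.-[1+_] a) b c) (ℚ.*<* ())

root : ℕ → ℕ → ℕ
root k n = ⌊√ k ℕ.* (suc n ℕ.* suc n) ⌋

root-≤ : ∀ k m n → frac (root k m) m ℚ.≤ frac (root k n) n ℚ.+ frac 1 n
root-≤ k m n = ℚ.≤-trans (frac-≤ {root k m} {m} {suc (root k n)} {n} (sq-cancel (ℕ.<⇒≤ squares)))
  (ℚ.≤-reflexive (frac-suc (root k n) n))
  where
  module S = ℕ.+-*-Solver
  sq-cancel : ∀ {a b} → a ℕ.* a ℕ.≤ b ℕ.* b → a ℕ.≤ b
  sq-cancel {a} {b} le with a ℕ.≤? b
  ... | yes a≤b = a≤b
  ... | no  a≰b with () ← ℕ.<⇒≱ (ℕ.*-mono-< (ℕ.≰⇒> a≰b) (ℕ.≰⇒> a≰b)) le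
  M = suc m
  N = suc n
  s = root k m
  t = suc (root k n)
  squares : (s ℕ.* N) ℕ.* (s ℕ.* N) ℕ.< (t ℕ.* M) ℕ.* (t ℕ.* M)
  squares = subst₂ ℕ._<_
    (S.solve 2 (λ s N → (s S.:* s) S.:* (N S.:* N) S.:= (s S.:* N) S.:* (s S.:* N)) refl s N)
    (S.solve 2 (λ t M → (t S.:* t) S.:* (M S.:* M) S.:= (t S.:* M) S.:* (t S.:* M)) refl t M)
    (ℕ.≤-<-trans (ℕ.*-monoˡ-≤ (N ℕ.* N) (⌊√⌋-lower (k ℕ.* (M ℕ.* M))))
      (subst (ℕ._< (t ℕ.* t) ℕ.* (M ℕ.* M))
        (S.solve 3 (λ k M N → (k S.:* (N S.:* N)) S.:* (M S.:* M) S.:= (k S.:* (M S.:* M)) S.:* (N S.:* N)) refl k M N)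
        (ℕ.*-monoˡ-< (M ℕ.* M) (⌊√⌋-upper (k ℕ.* (N ℕ.* N))))))

root-lower : ∀ k n → .{{NonZero k}} → suc n ℕ.≤ root k n
root-lower k n with suc n ℕ.≤? root k n
... | yes le = le
... | no  ≰ with () ← ℕ.<⇒≱ (⌊√⌋-upper (k ℕ.* (suc n ℕ.* suc n)))
                        (ℕ.≤-trans (ℕ.*-mono-≤ (ℕ.≰⇒> ≰) (ℕ.≰⇒> ≰)) (ℕ.m≤n*m (suc n ℕ.* suc n) k))

private abstract
  √-cauchy : ∀ k → Cauchy (λ n → frac (root k n) n)
  √-cauchy k ε 0<ε =
    let N , small = frac-small ε 0<ε in
    N , λ m n N≤m N≤n → dist-≤ {frac (root k m) m} {frac (root k n) n} {ε}
      (ℚ.≤-trans (root-≤ k m n) (ℚ.+-monoʳ-≤ (frac (root k n) n) (small n N≤n)))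
      (ℚ.≤-trans (root-≤ k n m) (ℚ.+-monoʳ-≤ (frac (root k m) m) (small m N≤m)))

-- √k is the limit of ⌊√(k(n+1)²)⌋ / (n+1).
opaque
  √_ : ℕ → ℝ
  √ k = mkℝ (λ n → frac (root k n) n) (√-cauchy k)

  √-pos : ∀ k → .{{NonZero k}} → 0ℝ <ℝ √ k
  √-pos k = 1ℚ , 0<1 , 0 , λ n _ → ℚ.≤-trans (ℚ.≤-reflexive (ℚ.+-identityˡ 1ℚ))
    (frac-≤ {1} {0} {root k n} {n}
      (subst₂ ℕ._≤_ (sym (ℕ.*-identityˡ (suc n))) (sym (ℕ.*-identityʳ (root k n))) (root-lower k n)))

infix 8 1/√_ √_

1/√_ : (k : ℕ) → .{{NonZero k}} → ℝ
1/√ k = recip (√ k) (√-pos k)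

------------------------------------------------------------------------
-- Matrices and spectra

∑ : ∀ {N} → Vector ℝ N → ℝ
∑ = foldr _+ℝ_ 0ℝ

Matrix : ℕ → Set
Matrix N = Fin N → Fin N → ℝ

infixl 7 _·_ _·ᵥ_

_·_ : ∀ {N} → Matrix N → Matrix N → Matrix N
(A · B) i j = ∑ λ k → A i k *ℝ B k j

_·ᵥ_ : ∀ {N} → Matrix N → Vector ℝ N → Vector ℝ N
(A ·ᵥ v) i = ∑ λ j → A i j *ℝ v j

diag : ∀ {N} → Vector ℝ N → Matrix N
diag d i j = if does (i Fin.≟ j) then d i else 0ℝ

record IsBasis {N : ℕ} (v : Fin N → Vector ℝ N) : Set where
  field
    independent : ∀ (c : Vector ℝ N) →
      (∀ i → ∑ (λ k → c k *ℝ v k i) ≃ℝ 0ℝ) → ∀ k → c k ≃ℝ 0ℝ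
    spanning : ∀ (w : Vector ℝ N) →
      Σ[ c ∈ Vector ℝ N ] (∀ i → w i ≃ℝ ∑ (λ k → c k *ℝ v k i))

-- The eigenvalues of a (real symmetric, hence diagonalisable) matrix in
-- decreasing order; the basis of eigenvectors makes each eigenvalue occur as
-- often as its multiplicity.
record Spectrum {N : ℕ} (A : Matrix N) : Set where
  field
    eigenvalue  : Fin N → ℝ
    eigenvector : Fin N → Vector ℝ N
    decreasing  : ∀ {i j} → i Fin.≤ j → eigenvalue j ≤ℝ eigenvalue i
    isEigen     : ∀ k i → (A ·ᵥ eigenvector k) i ≃ℝ eigenvalue k *ℝ eigenvector k i
    isBasis     : IsBasis eigenvector

open Spectrum public

-- max {λ₂ , |λ_N|}; the index of λ₂ is 1 and that of λ_N is N - 1.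
σ₂ : ∀ {N} {A : Matrix N} → 2 ℕ.≤ N → Spectrum A → ℝ
σ₂ {suc N} 2≤N S =
  eigenvalue S (fromℕ< 2≤N) ⊔ℝ ∣ eigenvalue S (Fin.fromℕ N) ∣ℝ

------------------------------------------------------------------------
-- Graphs

record Graph (N : ℕ) : Set where
  field
    adj       : Fin N → Fin N → Bool
    symmetric : ∀ u v → adj u v ≡ adj v u
    loopless  : ∀ v → adj v v ≡ false

open Graph public

module _ {N : ℕ} (G : Graph N) where

  neighbours : Fin N → Subset N
  neighbours v = tabulate (adj G v)

  degree : Fin N → ℕ
  degree v = ∣ neighbours v ∣

  NoIsolatedVertices : Set
  NoIsolatedVertices = ∀ v → NonZero (degree v)

  adjacencyMatrix : Matrix N
  adjacencyMatrix u v = if adj G u v then 1ℝ else 0ℝ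

  normalizedAdjacency : NoIsolatedVertices → Matrix N
  normalizedAdjacency deg≢0 = D^-½ · adjacencyMatrix · D^-½
    where
    D^-½ : Matrix N
    D^-½ = diag λ v → (1/√ degree v) {{deg≢0 v}}

  record IsSpectralExpander (ε : ℝ) : Set where
    field
      2≤N        : 2 ℕ.≤ N
      noIsolated : NoIsolatedVertices
      spectrum   : Spectrum (normalizedAdjacency noIsolated)
      σ₂≤ε       : σ₂ 2≤N spectrum ≤ℝ ε

  -- A perfect matching, as a set M of edges of G such that every vertex lies
  -- on exactly one edge of M.
  record PerfectMatching : Set where
    field
      M     : Graph N
      M⊆G   : ∀ u v → T (adj M u v) → T (adj G u v)
      cover : ∀ u → ∃! _≡_ λ v → T (adj M u v)

3≤⇒NonZero : ∀ {d} → 3 ℕ.≤ d → NonZero d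
3≤⇒NonZero (s≤s _) = _

{-# OPTIONS --safe #-}

-- Take a complete graph on r + 1 = 2n - 2 vertices and attach two pendant
-- vertices to one of its vertices, the apex. Both pendants can only be matched
-- to the apex, so there is no perfect matching. The spectrum of D^-½ A D^-½ is
-- that of the random walk D⁻¹A, whose eigenfunctions are explicit: the
-- constants (eigenvalue 1), the difference of the pendants (0), the differences
-- of two non-apex clique vertices (-1/r, with multiplicity r - 1), and two
-- functions constant on orbits, whose eigenvalues are the roots of
-- r(r+2)x² + (r+2)x = 2(r-1). All eigenvalues but the first are O(1/√r), so
-- they are at most 1/d ≤ 1/√d once r ≥ 8d².
module Submission where

open import Algebra.Bundles using (CommutativeRing)
import Algebra.Properties.Semiring.Sum as Sum
import Algebra.Solver.Ring as RingSolver
open import Algebra.Solver.Ring.AlmostCommutativeRing using (fromCommutativeRing; _-Raw-AlmostCommutative⟶_)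
open import Algebra.Structures using (IsCommutativeRing)
open import Data.Bool using (Bool; true; false; if_then_else_; T; not)
open import Data.Fin using (Fin; zero; suc; fromℕ; inject₁)
import Data.Fin as Fin
import Data.Fin.Properties as Fin
open import Data.Fin.Relation.Unary.Top using (view; ‵fromℕ; ‵inject₁)
open import Data.Fin.Subset using (∣_∣)
open import Data.Integer using (+_)
import Data.Integer as ℤ
import Data.Integer.Properties as ℤ
open import Data.Maybe using (Maybe; just; nothing)
open import Data.Nat using (ℕ; zero; suc; _*_; _≥_; _>_; z≤n; s≤s; NonZero)
import Data.Nat as ℕ
import Data.Nat.Properties as ℕ
import Data.Nat.Solver as ℕ
open import Data.Product using (Σ-syntax; _×_; _,_; proj₁; proj₂)
open import Data.Rational using (ℚ; 0ℚ; 1ℚ; ½)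
import Data.Rational as ℚ
import Data.Rational.Properties as ℚ
import Data.Rational.Solver as ℚ
open import Data.Rational.Unnormalised using (mkℚᵘ)
import Data.Rational.Unnormalised as ℚᵘ
import Data.Rational.Unnormalised.Properties as ℚᵘ
open import Data.Vec using (tabulate)
open import Data.Vec.Functional using (Vector)
open import Function using (case_of_)
import Relation.Binary.Reasoning.Setoid as SetoidReasoning
open import Relation.Binary.PropositionalEquality using (_≡_; refl; sym; trans; cong; cong₂; subst)
open import Relation.Nullary using (¬_; yes; no; does)
open import Defs

-- Null sequences of rationals

-- The normalization hides the obstruction from the spectrum: a pendant edge has entry 1/√(r + 2) in
-- the normalized matrix, so the star that blocks the matching only costs about √(2/r), the size of
-- the two quadratic roots. Since n₀ may depend on d, the value r = 2n - 3 can be pushed past 8d².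
--
-- The quadratic arises by normalizing an orbit function to 1 at the pendants. The pendant equation
-- makes its value at the apex equal to the eigenvalue x, orthogonality to the constants for the
-- degree measure fixes its value on the clique, and the apex equation becomes the quadratic.
--
-- The reals are Cauchy sequences, whose equality is not decidable, so the spectrum is built from
-- explicit data. Both halves of `IsBasis` are proved by formulas for the coefficients, with
-- explicit reciprocals of r, of the sum of the degrees and of the difference of the two roots.
-- Equalities reduce to ring identities modulo the relations that define these quantities; the
-- inequalities between eigenvalues hold entry by entry for the representing sequences.

Null : (ℕ → ℚ) → Set
Null s = ∀ ε → 0ℚ ℚ.< ε → Σ[ N ∈ ℕ ] (∀ n → N ℕ.≤ n → ℚ.∣ s n ∣ ℚ.≤ ε)

EventuallyBounded : (ℕ → ℚ) → Set
EventuallyBounded s = Σ[ B ∈ ℚ ] 0ℚ ℚ.< B × (Σ[ N ∈ ℕ ] (∀ n → N ℕ.≤ n → ℚ.∣ s n ∣ ℚ.≤ B))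

pos-* : ∀ {p q} → 0ℚ ℚ.< p → 0ℚ ℚ.< q → 0ℚ ℚ.< p ℚ.* q
pos-* {p} {q} 0<p 0<q = subst (ℚ._< p ℚ.* q) (ℚ.*-zeroʳ p)
  (ℚ.*-monoʳ-<-pos p {{ℚ.positive 0<p}} 0<q)

pos-1/ : ∀ {p} (0<p : 0ℚ ℚ.< p) → 0ℚ ℚ.< (ℚ.1/ p) {{ℚ.>-nonZero 0<p}}
pos-1/ {p} 0<p = ℚ.positive⁻¹ _ {{ℚ.1/pos⇒pos p {{ℚ.positive 0<p}}}}

nonNeg-* : ∀ {p q} → 0ℚ ℚ.≤ p → 0ℚ ℚ.≤ q → 0ℚ ℚ.≤ p ℚ.* q
nonNeg-* {p} {q} 0≤p 0≤q = subst (ℚ._≤ p ℚ.* q) (ℚ.*-zeroʳ p)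
  (ℚ.*-monoˡ-≤-nonNeg p {{ℚ.nonNegative 0≤p}} 0≤q)

0<1ℚ : 0ℚ ℚ.< 1ℚ
0<1ℚ = ℚ.positive⁻¹ 1ℚ

module _ where
  open ℚ.+-*-Solver using (solve; _:=_; _:+_; _:*_; :-_; _:-_; con)
  open ℚ.≤-Reasoning

  null-eventually : ∀ {s t} N → (∀ n → N ℕ.≤ n → s n ≡ t n) → Null s → Null t
  null-eventually N s≡t null ε 0<ε = let M , small = null ε 0<ε in
    N ℕ.⊔ M , λ n le → subst (λ p → ℚ.∣ p ∣ ℚ.≤ ε) (s≡t n (ℕ.≤-trans (ℕ.m≤m⊔n N M) le))
      (small n (ℕ.≤-trans (ℕ.m≤n⊔m N M) le))

  null-0 : Null (λ _ → 0ℚ)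
  null-0 ε 0<ε = 0 , λ _ _ → ℚ.<⇒≤ 0<ε

  null-squeeze : ∀ {s t} → (∀ n → ℚ.∣ s n ∣ ℚ.≤ ℚ.∣ t n ∣) → Null t → Null s
  null-squeeze s≤t null ε 0<ε = let N , small = null ε 0<ε in
    N , λ n le → ℚ.≤-trans (s≤t n) (small n le)

  null-neg : ∀ {s} → Null s → Null (λ n → ℚ.- s n)
  null-neg {s} = null-squeeze λ n → ℚ.≤-reflexive (ℚ.∣-p∣≡∣p∣ (s n))

  null-+ : ∀ {s t} → Null s → Null t → Null (λ n → s n ℚ.+ t n)
  null-+ {s} {t} null-s null-t ε 0<ε =
    let 0<½ε = pos-* (ℚ.positive⁻¹ ½) 0<ε
        N , small-s = null-s (½ ℚ.* ε) 0<½ε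
        M , small-t = null-t (½ ℚ.* ε) 0<½ε
    in N ℕ.⊔ M , λ n le → begin
      ℚ.∣ s n ℚ.+ t n ∣          ≤⟨ ℚ.∣p+q∣≤∣p∣+∣q∣ (s n) (t n) ⟩
      ℚ.∣ s n ∣ ℚ.+ ℚ.∣ t n ∣    ≤⟨ ℚ.+-mono-≤ (small-s n (ℕ.≤-trans (ℕ.m≤m⊔n N M) le))
                                      (small-t n (ℕ.≤-trans (ℕ.m≤n⊔m N M) le)) ⟩
      ½ ℚ.* ε ℚ.+ ½ ℚ.* ε        ≡⟨ solve 1 (λ e → con ½ :* e :+ con ½ :* e := e) refl ε ⟩
      ε                          ∎

  null-* : ∀ {s t} → EventuallyBounded s → Null t → Null (λ n → s n ℚ.* t n)
  null-* {s} {t} (B , 0<B , N , s≤B) null-t ε 0<ε =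
    let M , small = null-t (ε ℚ.* ℚ.1/ B) (pos-* 0<ε (pos-1/ 0<B)) in
    N ℕ.⊔ M , λ n le → begin
      ℚ.∣ s n ℚ.* t n ∣         ≡⟨ ℚ.∣p*q∣≡∣p∣*∣q∣ (s n) (t n) ⟩
      ℚ.∣ s n ∣ ℚ.* ℚ.∣ t n ∣   ≤⟨ ℚ.*-monoʳ-≤-nonNeg ℚ.∣ t n ∣ {{ℚ.nonNegative (ℚ.0≤∣p∣ (t n))}}
                                     (s≤B n (ℕ.≤-trans (ℕ.m≤m⊔n N M) le)) ⟩
      B ℚ.* ℚ.∣ t n ∣           ≤⟨ ℚ.*-monoˡ-≤-nonNeg B {{ℚ.nonNegative (ℚ.<⇒≤ 0<B)}}
                                     (small n (ℕ.≤-trans (ℕ.m≤n⊔m N M) le)) ⟩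
      B ℚ.* (ε ℚ.* ℚ.1/ B)      ≡⟨ solve 3 (λ b e i → b :* (e :* i) := e :* (b :* i)) refl B ε (ℚ.1/ B) ⟩
      ε ℚ.* (B ℚ.* ℚ.1/ B)      ≡⟨ cong (ε ℚ.*_) (ℚ.*-inverseʳ B) ⟩
      ε ℚ.* 1ℚ                  ≡⟨ ℚ.*-identityʳ ε ⟩
      ε                         ∎
    where
    instance
      B≢0 : ℚ.NonZero B
      B≢0 = ℚ.>-nonZero 0<B

  eventually-bounded : ∀ x → EventuallyBounded (seq x)
  eventually-bounded x =
    let N , close = cauchy x 1ℚ 0<1ℚ in
    ℚ.∣ seq x N ∣ ℚ.+ 1ℚ , ℚ.+-mono-≤-< (ℚ.0≤∣p∣ (seq x N)) 0<1ℚ , N , λ n N≤n → begin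
      ℚ.∣ seq x n ∣
        ≡⟨ cong ℚ.∣_∣ (solve 2 (λ a b → a := b :+ (a :- b)) refl (seq x n) (seq x N)) ⟩
      ℚ.∣ seq x N ℚ.+ (seq x n ℚ.- seq x N) ∣
        ≤⟨ ℚ.∣p+q∣≤∣p∣+∣q∣ (seq x N) (seq x n ℚ.- seq x N) ⟩
      ℚ.∣ seq x N ∣ ℚ.+ ℚ.∣ seq x n ℚ.- seq x N ∣
        ≤⟨ ℚ.+-monoʳ-≤ ℚ.∣ seq x N ∣ (close n N N≤n ℕ.≤-refl) ⟩
      ℚ.∣ seq x N ∣ ℚ.+ 1ℚ ∎

-- The commutative ring of real numbers

infix 4 _≈_

-- A record, unlike the function type _≃ℝ_, lets unification recover x and y.
record _≈_ (x y : ℝ) : Set where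
  constructor mk≈
  field un≈ : x ≃ℝ y

open _≈_

≡-eventually⇒≈ : ∀ {x y} N → (∀ n → N ℕ.≤ n → seq x n ≡ seq y n) → x ≈ y
≡-eventually⇒≈ {x} {y} N eq = mk≈ (null-eventually N
  (λ n le → sym (trans (cong (ℚ._- seq y n) (eq n le)) (ℚ.+-inverseʳ (seq y n)))) null-0)

≗⇒≈ : ∀ {x y} → (∀ n → seq x n ≡ seq y n) → x ≈ y
≗⇒≈ eq = ≡-eventually⇒≈ 0 (λ n _ → eq n)

module _ where
  open ℚ.+-*-Solver using (solve; _:=_; _:+_; _:*_; :-_; _:-_; con)

  ≈-sym : ∀ {x y} → x ≈ y → y ≈ x
  ≈-sym {x} {y} (mk≈ p) = mk≈ (null-eventually 0
    (λ n _ → solve 2 (λ a b → :- (a :- b) := b :- a) refl (seq x n) (seq y n)) (null-neg p))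

  ≈-trans : ∀ {x y z} → x ≈ y → y ≈ z → x ≈ z
  ≈-trans {x} {y} {z} (mk≈ p) (mk≈ q) = mk≈ (null-eventually 0
    (λ n _ → solve 3 (λ a b c → (a :- b) :+ (b :- c) := a :- c) refl (seq x n) (seq y n) (seq z n))
    (null-+ p q))

  opaque
    unfolding _+ℝ_

    +-cong : ∀ {x y u v} → x ≈ y → u ≈ v → x +ℝ u ≈ y +ℝ v
    +-cong {x} {y} {u} {v} (mk≈ p) (mk≈ q) = mk≈ (null-eventually 0
      (λ n _ → solve 4 (λ a b c d → (a :- b) :+ (c :- d) := (a :+ c) :- (b :+ d)) refl
        (seq x n) (seq y n) (seq u n) (seq v n))
      (null-+ p q))

    neg-cong : ∀ {x y} → x ≈ y → -ℝ x ≈ -ℝ y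
    neg-cong {x} {y} (mk≈ p) = mk≈ (null-eventually 0
      (λ n _ → solve 2 (λ a b → :- (a :- b) := :- a :- :- b) refl (seq x n) (seq y n)) (null-neg p))

    -- The difference of the products splits as a(c - d) + d(a - b), and each summand is a bounded
    -- sequence times a null one.
    *-cong : ∀ {x y u v} → x ≈ y → u ≈ v → x *ℝ u ≈ y *ℝ v
    *-cong {x} {y} {u} {v} (mk≈ p) (mk≈ q) = mk≈ (null-eventually 0
      (λ n _ → solve 4 (λ a b c d → a :* (c :- d) :+ d :* (a :- b) := a :* c :- b :* d) refl
        (seq x n) (seq y n) (seq u n) (seq v n))
      (null-+ (null-* (eventually-bounded x) q) (null-* (eventually-bounded v) p)))

    ℝ-isCommutativeRing : IsCommutativeRing _≈_ _+ℝ_ _*ℝ_ -ℝ_ 0ℝ 1ℝ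
    ℝ-isCommutativeRing = record
      { isRing = record
        { +-isAbelianGroup = record
          { isGroup = record
            { isMonoid = record
              { isSemigroup = record
                { isMagma = record
                  { isEquivalence = record { refl = ≗⇒≈ λ _ → refl ; sym = ≈-sym ; trans = ≈-trans }
                  ; ∙-cong = +-cong
                  }
                ; assoc = λ x y z → ≗⇒≈ λ n → ℚ.+-assoc (seq x n) (seq y n) (seq z n)
                }
              ; identity = (λ x → ≗⇒≈ λ n → ℚ.+-identityˡ (seq x n)) , (λ x → ≗⇒≈ λ n → ℚ.+-identityʳ (seq x n))
              }
            ; inverse = (λ x → ≗⇒≈ λ n → ℚ.+-inverseˡ (seq x n)) , (λ x → ≗⇒≈ λ n → ℚ.+-inverseʳ (seq x n))
            ; ⁻¹-cong = neg-cong
            }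
          ; comm = λ x y → ≗⇒≈ λ n → ℚ.+-comm (seq x n) (seq y n)
          }
        ; *-cong = *-cong
        ; *-assoc = λ x y z → ≗⇒≈ λ n → ℚ.*-assoc (seq x n) (seq y n) (seq z n)
        ; *-identity = (λ x → ≗⇒≈ λ n → ℚ.*-identityˡ (seq x n)) , (λ x → ≗⇒≈ λ n → ℚ.*-identityʳ (seq x n))
        ; distrib = (λ x y z → ≗⇒≈ λ n → ℚ.*-distribˡ-+ (seq x n) (seq y n) (seq z n))
                  , (λ x y z → ≗⇒≈ λ n → ℚ.*-distribʳ-+ (seq x n) (seq y n) (seq z n))
        }
      ; *-comm = λ x y → ≗⇒≈ λ n → ℚ.*-comm (seq x n) (seq y n)
      }

    fromℚ-+ : ∀ p q → fromℚ (p ℚ.+ q) ≈ fromℚ p +ℝ fromℚ q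
    fromℚ-+ p q = ≗⇒≈ λ _ → refl

    fromℚ-* : ∀ p q → fromℚ (p ℚ.* q) ≈ fromℚ p *ℝ fromℚ q
    fromℚ-* p q = ≗⇒≈ λ _ → refl

    fromℚ-neg : ∀ p → fromℚ (ℚ.- p) ≈ -ℝ fromℚ p
    fromℚ-neg p = ≗⇒≈ λ _ → refl

ℝ-commutativeRing : CommutativeRing _ _
ℝ-commutativeRing = record { isCommutativeRing = ℝ-isCommutativeRing }

open CommutativeRing ℝ-commutativeRing using (semiring; setoid; +-congˡ; +-congʳ; *-congˡ; *-congʳ)
  renaming (refl to ≈-refl; reflexive to ≡⇒≈; +-identityˡ to +ℝ-identityˡ; +-identityʳ to +ℝ-identityʳ;
            *-identityˡ to *ℝ-identityˡ; *-identityʳ to *ℝ-identityʳ; *-assoc to *ℝ-assoc; zeroˡ to *ℝ-zeroˡ; zeroʳ to *ℝ-zeroʳ)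

-- Lets the ring solver compute with coefficients in ℚ, where equality is decidable, while its atoms
-- are reals; identities may then contain constants such as `½`.
fromℚ-morphism : CommutativeRing.rawRing ℚ.+-*-commutativeRing -Raw-AlmostCommutative⟶ fromCommutativeRing ℝ-commutativeRing
fromℚ-morphism = record
  { ⟦_⟧    = fromℚ
  ; +-homo = fromℚ-+
  ; *-homo = fromℚ-*
  ; -‿homo = fromℚ-neg
  ; 0-homo = ≈-refl
  ; 1-homo = ≈-refl
  }

fromℚ-≟ : ∀ p q → Maybe (fromℚ p ≈ fromℚ q)
fromℚ-≟ p q with p ℚ.≟ q
... | yes refl = just ≈-refl
... | no _     = nothing

module ℝ-Solver = RingSolver (CommutativeRing.rawRing ℚ.+-*-commutativeRing)
  (fromCommutativeRing ℝ-commutativeRing) fromℚ-morphism fromℚ-≟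

-- Fractions, square roots and reciprocals

-- `frac a n` has denominator n + 1, so the index on the right is the predecessor of (m + 1)(n + 1).
frac-* : ∀ a m b n → frac a m ℚ.* frac b n ≡ frac (a ℕ.* b) (n ℕ.+ m ℕ.* suc n)
frac-* a m b n = ℚ.toℚᵘ-injective (ℚᵘ.≃-trans (ℚ.toℚᵘ-homo-* (frac a m) (frac b n)) (ℚᵘ.≃-trans
  (ℚᵘ.*-cong (ℚ.toℚᵘ-fromℚᵘ (mkℚᵘ (+ a) m)) (ℚ.toℚᵘ-fromℚᵘ (mkℚᵘ (+ b) n)))
  (ℚᵘ.≃-trans (ℚᵘ.*≡* (cong (ℤ._* (+ suc (n ℕ.+ m ℕ.* suc n))) (sym (ℤ.pos-* a b))))
  (ℚᵘ.≃-sym (ℚ.toℚᵘ-fromℚᵘ (mkℚᵘ (+ (a ℕ.* b)) (n ℕ.+ m ℕ.* suc n)))))))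

frac-+ : ∀ a b n → frac (a ℕ.+ b) n ≡ frac a n ℚ.+ frac b n
frac-+ zero    b n = sym (trans (cong (ℚ._+ frac b n) (ℚ.≤-antisym (frac-≤ {0} {n} {0} {0} z≤n) (frac-≤ {0} {0} {0} {n} z≤n)))
  (ℚ.+-identityˡ (frac b n)))
frac-+ (suc a) b n = trans (frac-suc (a ℕ.+ b) n) (trans (cong (ℚ._+ frac 1 n) (frac-+ a b n))
  (trans (solve 3 (λ x y z → (x :+ y) :+ z := (x :+ z) :+ y) refl (frac a n) (frac b n) (frac 1 n))
    (cong (ℚ._+ frac b n) (sym (frac-suc a n)))))
  where open ℚ.+-*-Solver using (solve; _:=_; _:+_)

frac-nonNeg : ∀ a n → 0ℚ ℚ.≤ frac a n
frac-nonNeg a n = frac-≤ {0} {0} {a} {n} z≤n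

⟦_⟧ : ℕ → ℚ
⟦ a ⟧ = frac a 0

⟦⟧-* : ∀ a b → ⟦ a ℕ.* b ⟧ ≡ ⟦ a ⟧ ℚ.* ⟦ b ⟧
⟦⟧-* a b = sym (frac-* a 0 b 0)

⟦⟧-mono : ∀ {a b} → a ℕ.≤ b → ⟦ a ⟧ ℚ.≤ ⟦ b ⟧
⟦⟧-mono {a} {b} le = frac-≤ {a} {0} {b} {0} (ℕ.*-monoˡ-≤ 1 le)

frac-inverse : ∀ n → frac 1 n ℚ.* ⟦ suc n ⟧ ≡ 1ℚ
frac-inverse n = trans (frac-* 1 n (suc n) 0) (ℚ.≤-antisym
  (frac-≤ {1 ℕ.* suc n} {0 ℕ.+ n ℕ.* 1} {1} {0} (ℕ.≤-reflexive eq))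
  (frac-≤ {1} {0} {1 ℕ.* suc n} {0 ℕ.+ n ℕ.* 1} (ℕ.≤-reflexive (sym eq))))
  where
  eq : 1 ℕ.* suc n ℕ.* 1 ≡ 1 ℕ.* suc (0 ℕ.+ n ℕ.* 1)
  eq = ℕ.*-assoc 1 (suc n) 1

frac-null : Null (frac 1)
frac-null ε 0<ε = let N , small = frac-small ε 0<ε in
  N , λ n le → ℚ.≤-trans (ℚ.≤-reflexive (ℚ.0≤p⇒∣p∣≡p (frac-nonNeg 1 n))) (small n le)

private
  square-cancel-≤ : ∀ {a b} → a ℕ.* a ℕ.≤ b ℕ.* b → a ℕ.≤ b
  square-cancel-≤ {a} {b} le = ℕ.≮⇒≥ λ b<a → ℕ.<⇒≱ (ℕ.*-mono-< b<a b<a) le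

-- This is √k ≤ c/(d + 1) for the nth approximation of √k, with denominators cleared; it is checked
-- after squaring, where the floor root is controlled.
root-upper : ∀ k {c d} → k ℕ.* (suc d ℕ.* suc d) ℕ.≤ c ℕ.* c → ∀ n → root k n ℕ.* suc d ℕ.≤ c ℕ.* suc n
root-upper k {c} {d} le n = square-cancel-≤ (begin
  root k n ℕ.* suc d ℕ.* (root k n ℕ.* suc d)     ≡⟨ ℕ.[m*n]*[o*p]≡[m*o]*[n*p] (root k n) (suc d) (root k n) (suc d) ⟩
  root k n ℕ.* root k n ℕ.* (suc d ℕ.* suc d)     ≤⟨ ℕ.*-monoˡ-≤ (suc d ℕ.* suc d) (⌊√⌋-lower (k ℕ.* (suc n ℕ.* suc n))) ⟩
  k ℕ.* (suc n ℕ.* suc n) ℕ.* (suc d ℕ.* suc d)   ≡⟨ solve 3 (λ k a b → k :* a :* b := k :* b :* a) refl k (suc n ℕ.* suc n) (suc d ℕ.* suc d) ⟩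
  k ℕ.* (suc d ℕ.* suc d) ℕ.* (suc n ℕ.* suc n)   ≤⟨ ℕ.*-monoˡ-≤ (suc n ℕ.* suc n) le ⟩
  c ℕ.* c ℕ.* (suc n ℕ.* suc n)                   ≡⟨ ℕ.[m*n]*[o*p]≡[m*o]*[n*p] c c (suc n) (suc n) ⟩
  c ℕ.* suc n ℕ.* (c ℕ.* suc n)                   ∎)
  where
  open ℕ.≤-Reasoning
  open ℕ.+-*-Solver using (solve; _:=_; _:*_)

root-greatest : ∀ k {c} → c ℕ.* c ℕ.≤ k → ∀ n → c ℕ.* suc n ℕ.≤ root k n
root-greatest k {c} le n = ℕ.≮⇒≥ λ lt → ℕ.<⇒≱ (⌊√⌋-upper (k ℕ.* (suc n ℕ.* suc n))) (begin
  suc (root k n) ℕ.* suc (root k n)   ≤⟨ ℕ.*-mono-≤ lt lt ⟩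
  c ℕ.* suc n ℕ.* (c ℕ.* suc n)       ≡⟨ ℕ.[m*n]*[o*p]≡[m*o]*[n*p] c (suc n) c (suc n) ⟩
  c ℕ.* c ℕ.* (suc n ℕ.* suc n)       ≤⟨ ℕ.*-monoˡ-≤ (suc n ℕ.* suc n) le ⟩
  k ℕ.* (suc n ℕ.* suc n)             ∎)
  where open ℕ.≤-Reasoning

module _ (k : ℕ) where
  open ℚ.+-*-Solver using (solve; _:=_; _:+_; _:*_; :-_; _:-_; con)
  open ℚ.≤-Reasoning

  root-square-lower : ∀ n → frac (root k n) n ℚ.* frac (root k n) n ℚ.≤ ⟦ k ⟧
  root-square-lower n = subst (ℚ._≤ ⟦ k ⟧) (sym (frac-* (root k n) n (root k n) n))
    (frac-≤ {root k n ℕ.* root k n} {n ℕ.+ n ℕ.* suc n} {k} {0}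
      (subst (ℕ._≤ k ℕ.* (suc n ℕ.* suc n)) (sym (ℕ.*-identityʳ _)) (⌊√⌋-lower (k ℕ.* (suc n ℕ.* suc n)))))

  root-square-upper : ∀ n → ⟦ k ⟧ ℚ.≤ (frac (root k n) n ℚ.+ frac 1 n) ℚ.* (frac (root k n) n ℚ.+ frac 1 n)
  root-square-upper n = subst (⟦ k ⟧ ℚ.≤_)
    (trans (sym (frac-* q n q n)) (cong₂ ℚ._*_ (frac-suc (root k n) n) (frac-suc (root k n) n)))
    (frac-≤ {k} {0} {q ℕ.* q} {n ℕ.+ n ℕ.* suc n}
      (subst (k ℕ.* (suc n ℕ.* suc n) ℕ.≤_) (sym (ℕ.*-identityʳ _)) (ℕ.<⇒≤ (⌊√⌋-upper (k ℕ.* (suc n ℕ.* suc n))))))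
    where q = suc (root k n)

  opaque
    unfolding _+ℝ_ √_

    -- For the nth approximation x, x² ≤ k ≤ (x + 1/(n + 1))². The error is therefore at most (2x +
    -- 1)/(n + 1), a bounded sequence times a null one.
    √-square : √ k *ℝ √ k ≈ fromℚ ⟦ k ⟧
    √-square = mk≈ (null-squeeze bound (null-* bounded frac-null))
      where
      x : ℕ → ℚ
      x n = frac (root k n) n
      bounded : EventuallyBounded (λ n → x n ℚ.+ x n ℚ.+ 1ℚ)
      bounded = eventually-bounded (√ k +ℝ √ k +ℝ 1ℝ)
      0≤2x+1 : ∀ n → 0ℚ ℚ.≤ x n ℚ.+ x n ℚ.+ 1ℚ
      0≤2x+1 n = ℚ.+-mono-≤ (ℚ.+-mono-≤ (frac-nonNeg (root k n) n) (frac-nonNeg (root k n) n)) (ℚ.<⇒≤ 0<1ℚ)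
      bound : ∀ n → ℚ.∣ x n ℚ.* x n ℚ.- ⟦ k ⟧ ∣ ℚ.≤ ℚ.∣ (x n ℚ.+ x n ℚ.+ 1ℚ) ℚ.* frac 1 n ∣
      bound n = begin
        ℚ.∣ x n ℚ.* x n ℚ.- ⟦ k ⟧ ∣
          ≡⟨ ℚ.∣-p∣≡∣p∣ (x n ℚ.* x n ℚ.- ⟦ k ⟧) ⟨
        ℚ.∣ ℚ.- (x n ℚ.* x n ℚ.- ⟦ k ⟧) ∣
          ≡⟨ cong ℚ.∣_∣ (solve 2 (λ a b → :- (a :- b) := b :- a) refl (x n ℚ.* x n) ⟦ k ⟧) ⟩
        ℚ.∣ ⟦ k ⟧ ℚ.- x n ℚ.* x n ∣
          ≡⟨ ℚ.0≤p⇒∣p∣≡p (subst (ℚ._≤ ⟦ k ⟧ ℚ.- x n ℚ.* x n) (ℚ.+-inverseʳ (x n ℚ.* x n))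
               (ℚ.+-monoˡ-≤ (ℚ.- (x n ℚ.* x n)) (root-square-lower n))) ⟩
        ⟦ k ⟧ ℚ.- x n ℚ.* x n
          ≤⟨ ℚ.+-monoˡ-≤ (ℚ.- (x n ℚ.* x n)) (root-square-upper n) ⟩
        (x n ℚ.+ frac 1 n) ℚ.* (x n ℚ.+ frac 1 n) ℚ.- x n ℚ.* x n
          ≡⟨ solve 2 (λ a f → (a :+ f) :* (a :+ f) :- a :* a := (a :+ a :+ f) :* f) refl (x n) (frac 1 n) ⟩
        (x n ℚ.+ x n ℚ.+ frac 1 n) ℚ.* frac 1 n
          ≤⟨ ℚ.*-monoʳ-≤-nonNeg (frac 1 n) {{ℚ.nonNegative (frac-nonNeg 1 n)}}
               (ℚ.+-monoʳ-≤ (x n ℚ.+ x n) (frac-≤ {1} {n} {1} {0} (ℕ.*-monoʳ-≤ 1 (s≤s (z≤n {n}))))) ⟩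
        (x n ℚ.+ x n ℚ.+ 1ℚ) ℚ.* frac 1 n
          ≡⟨ ℚ.0≤p⇒∣p∣≡p (nonNeg-* (0≤2x+1 n) (frac-nonNeg 1 n)) ⟨
        ℚ.∣ (x n ℚ.+ x n ℚ.+ 1ℚ) ℚ.* frac 1 n ∣ ∎

    √-upper : ∀ {c d} → k ℕ.* (suc d ℕ.* suc d) ℕ.≤ c ℕ.* c → ∀ n → seq (√ k) n ℚ.≤ frac c d
    √-upper {c} {d} le n = frac-≤ {root k n} {n} {c} {d} (root-upper k {c} le n)

    √-lower : ∀ {c} → c ℕ.* c ℕ.≤ k → ∀ n → ⟦ c ⟧ ℚ.≤ seq (√ k) n
    √-lower {c} le n = frac-≤ {c} {0} {root k n} {n}
      (subst (c ℕ.* suc n ℕ.≤_) (sym (ℕ.*-identityʳ (root k n))) (root-greatest k {c} le n))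

module _ where
  open ℚ.≤-Reasoning

  recipℚ-inverse : ∀ {e} (0<e : 0ℚ ℚ.< e) p → (p ℚ.⊔ e) ℚ.* recipℚ 0<e p ≡ 1ℚ
  recipℚ-inverse {e} 0<e p = ℚ.*-inverseʳ (p ℚ.⊔ e) {{ℚ.>-nonZero (ℚ.<-≤-trans 0<e (ℚ.p≤q⊔p p e))}}

  recipℚ-lower : ∀ {e} (0<e : 0ℚ ℚ.< e) p {q} → q ℚ.* (p ℚ.⊔ e) ℚ.≤ 1ℚ → q ℚ.≤ recipℚ 0<e p
  recipℚ-lower {e} 0<e p {q} le =
    ℚ.*-cancelʳ-≤-pos (p ℚ.⊔ e) {{ℚ.positive (ℚ.<-≤-trans 0<e (ℚ.p≤q⊔p p e))}} (begin
      q ℚ.* (p ℚ.⊔ e)                ≤⟨ le ⟩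
      1ℚ                             ≡⟨ recipℚ-inverse 0<e p ⟨
      (p ℚ.⊔ e) ℚ.* recipℚ 0<e p     ≡⟨ ℚ.*-comm (p ℚ.⊔ e) (recipℚ 0<e p) ⟩
      recipℚ 0<e p ℚ.* (p ℚ.⊔ e)     ∎)

  opaque
    unfolding _+ℝ_ recip

    -- From index N on the sequence is at least e, so the truncation max(xₙ, e) is xₙ itself and the
    -- product is exactly 1.
    recip-inverse : ∀ x (0<x : 0ℝ <ℝ x) → x *ℝ recip x 0<x ≈ 1ℝ
    recip-inverse x (e , 0<e , N , e≤x) = ≡-eventually⇒≈ N λ n N≤n →
      trans (cong (ℚ._* recipℚ 0<e (seq x n))
              (sym (ℚ.p≥q⇒p⊔q≡p (subst (ℚ._≤ seq x n) (ℚ.+-identityˡ e) (e≤x n N≤n)))))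
            (recipℚ-inverse 0<e (seq x n))

  √-inverse : ∀ k .{{_ : NonZero k}} → √ k *ℝ 1/√ k ≈ 1ℝ
  √-inverse k = recip-inverse (√ k) (√-pos k)

  opaque
    unfolding √_ recip

    -- The approximations of √(d + 1) are at most d + 1, and so is 1, the truncation level that
    -- `√-pos` supplies to `recip`.
    1/√-lower : ∀ d n → frac 1 d ℚ.≤ seq (1/√ suc d) n
    1/√-lower d n = recipℚ-lower 0<1ℚ (seq (√ suc d) n) (begin
      frac 1 d ℚ.* (seq (√ suc d) n ℚ.⊔ 1ℚ)
        ≤⟨ ℚ.*-monoˡ-≤-nonNeg (frac 1 d) {{ℚ.nonNegative (frac-nonNeg 1 d)}}
             (ℚ.⊔-lub (√-upper (suc d) {suc d} {0} (ℕ.*-monoʳ-≤ (suc d) (s≤s z≤n)) n)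
                      (⟦⟧-mono {1} {suc d} (s≤s z≤n))) ⟩
      frac 1 d ℚ.* ⟦ suc d ⟧
        ≡⟨ frac-inverse d ⟩
      1ℚ ∎)

infix 4 _⊑_

-- Compares the representing sequences, so it does not respect _≈_.
record _⊑_ (x y : ℝ) : Set where
  constructor mk⊑
  field un⊑ : ∀ n → seq x n ℚ.≤ seq y n

open _⊑_

⊑-refl : ∀ {x} → x ⊑ x
⊑-refl = mk⊑ λ _ → ℚ.≤-refl

⊑-trans : ∀ {x y z} → x ⊑ y → y ⊑ z → x ⊑ z
⊑-trans (mk⊑ p) (mk⊑ q) = mk⊑ λ n → ℚ.≤-trans (p n) (q n)

⊑⇒≤ : ∀ {x y} → x ⊑ y → x ≤ℝ y
⊑⇒≤ {x} {y} (mk⊑ le) ε 0<ε = 0 , λ n _ → begin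
  seq x n           ≤⟨ le n ⟩
  seq y n           ≡⟨ ℚ.+-identityʳ (seq y n) ⟨
  seq y n ℚ.+ 0ℚ    ≤⟨ ℚ.+-monoʳ-≤ (seq y n) (ℚ.<⇒≤ 0<ε) ⟩
  seq y n ℚ.+ ε     ∎
  where open ℚ.≤-Reasoning

-- Sums

open Sum semiring using (*-distribˡ-sum; *-distribʳ-sum; sum-cong-≋; sum-init-last; sum-replicate-zero; ∑-distrib-+)
module ≈-Reasoning = SetoidReasoning setoid

∑-cong : ∀ {N} {f g : Vector ℝ N} → (∀ i → f i ≈ g i) → ∑ f ≈ ∑ g
∑-cong = sum-cong-≋

-- Two mirror versions are needed: multiplying by a diagonal matrix on the left sums over the second
-- argument of `≟`, on the right over the first.
∑-≟ˡ : ∀ {N} (i : Fin N) (f : Vector ℝ N) → ∑ (λ k → if does (i Fin.≟ k) then f k else 0ℝ) ≈ f i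
∑-≟ˡ {suc N} zero    f = ≈-trans (+-congˡ (sum-replicate-zero N)) (+ℝ-identityʳ (f zero))
∑-≟ˡ {suc N} (suc i) f = ≈-trans (+ℝ-identityˡ _) (∑-≟ˡ i (λ k → f (suc k)))

∑-≟ʳ : ∀ {N} (i : Fin N) (f : Vector ℝ N) → ∑ (λ k → if does (k Fin.≟ i) then f k else 0ℝ) ≈ f i
∑-≟ʳ {suc N} zero    f = ≈-trans (+-congˡ (sum-replicate-zero N)) (+ℝ-identityʳ (f zero))
∑-≟ʳ {suc N} (suc i) f = ≈-trans (+ℝ-identityˡ _) (∑-≟ʳ i (λ k → f (suc k)))

if-*ˡ : ∀ b x y → (if b then x else 0ℝ) *ℝ y ≈ (if b then x *ℝ y else 0ℝ)
if-*ˡ true  x y = ≈-refl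
if-*ˡ false x y = *ℝ-zeroˡ y

if-*ʳ : ∀ b x y → x *ℝ (if b then y else 0ℝ) ≈ (if b then x *ℝ y else 0ℝ)
if-*ʳ true  x y = ≈-refl
if-*ʳ false x y = *ℝ-zeroʳ x

-- Identifies a row sum of the adjacency matrix with the degree, so that walk equations can be
-- phrased by row sums alone.
∑-indicator : ∀ {N} (b : Fin N → Bool) → ∑ (λ v → if b v then 1ℝ else 0ℝ) ≈ fromℚ ⟦ ∣ tabulate b ∣ ⟧
∑-indicator {zero}  b = ≈-refl
∑-indicator {suc N} b with b zero
... | false = ≈-trans (+ℝ-identityˡ _) (∑-indicator (λ v → b (suc v)))
... | true  = begin
  1ℝ +ℝ ∑ (λ v → if b (suc v) then 1ℝ else 0ℝ)   ≈⟨ +-congˡ (∑-indicator (λ v → b (suc v))) ⟩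
  1ℝ +ℝ fromℚ ⟦ m ⟧                              ≈⟨ fromℚ-+ 1ℚ ⟦ m ⟧ ⟨
  fromℚ (1ℚ ℚ.+ ⟦ m ⟧)                           ≡⟨ cong fromℚ (frac-+ 1 m 0) ⟨
  fromℚ ⟦ suc m ⟧                                ∎
  where
  open ≈-Reasoning
  m = ∣ tabulate (λ v → b (suc v)) ∣

-- Eigenvectors of the normalized adjacency matrix from those of the random walk

module _ {N : ℕ} (G : Graph N) (deg≢0 : NoIsolatedVertices G) where
  open ≈-Reasoning
  open ℝ-Solver using (solve; _:=_; _:+_; _:*_; :-_; _:-_; con)

  private
    A : Matrix N
    A = adjacencyMatrix G
    √d : Vector ℝ N
    √d v = √ degree G v
    1/√d : Vector ℝ N
    1/√d v = (1/√ degree G v) {{deg≢0 v}}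
    √d-inverse : ∀ v → √d v *ℝ 1/√d v ≈ 1ℝ
    √d-inverse v = √-inverse (degree G v) {{deg≢0 v}}

  normalizedAdjacency-entry : ∀ u v → normalizedAdjacency G deg≢0 u v ≈ 1/√d u *ℝ A u v *ℝ 1/√d v
  normalizedAdjacency-entry u v = begin
    ∑ (λ k → ∑ (λ l → diag 1/√d u l *ℝ A l k) *ℝ diag 1/√d k v)
      ≈⟨ ∑-cong (λ k → *-congʳ (≈-trans
           (∑-cong (λ l → if-*ˡ (does (u Fin.≟ l)) (1/√d u) (A l k)))
           (∑-≟ˡ u (λ l → 1/√d u *ℝ A l k)))) ⟩
    ∑ (λ k → 1/√d u *ℝ A u k *ℝ diag 1/√d k v)
      ≈⟨ ∑-cong (λ k → if-*ʳ (does (k Fin.≟ v)) (1/√d u *ℝ A u k) (1/√d k)) ⟩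
    ∑ (λ k → if does (k Fin.≟ v) then 1/√d u *ℝ A u k *ℝ 1/√d k else 0ℝ)
      ≈⟨ ∑-≟ʳ v (λ k → 1/√d u *ℝ A u k *ℝ 1/√d k) ⟩
    1/√d u *ℝ A u v *ℝ 1/√d v ∎

  -- The hypothesis is A f = μ D f, the division-free form of D⁻¹A f = μ f. Conjugation by D^½ turns
  -- D⁻¹A into the normalized matrix, so D^½ f is an eigenvector for the same μ.
  scaled-eigenvector : ∀ μ (f : Vector ℝ N) →
    (∀ u → ∑ (λ v → A u v *ℝ f v) ≈ μ *ℝ ∑ (A u) *ℝ f u) →
    ∀ u → (normalizedAdjacency G deg≢0 ·ᵥ λ v → √d v *ℝ f v) u ≈ μ *ℝ (√d u *ℝ f u)
  scaled-eigenvector μ f eigen u = begin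
    ∑ (λ v → normalizedAdjacency G deg≢0 u v *ℝ (√d v *ℝ f v))
      ≈⟨ ∑-cong (λ v → ≈-trans (*-congʳ (normalizedAdjacency-entry u v))
           (≈-trans (solve 5 (λ x a y s f → x :* a :* y :* (s :* f) := s :* y :* (x :* (a :* f))) ≈-refl
                      (1/√d u) (A u v) (1/√d v) (√d v) (f v))
           (≈-trans (*-congʳ (√d-inverse v)) (*ℝ-identityˡ _)))) ⟩
    ∑ (λ v → 1/√d u *ℝ (A u v *ℝ f v))
      ≈⟨ *-distribˡ-sum (1/√d u) (λ v → A u v *ℝ f v) ⟨
    1/√d u *ℝ ∑ (λ v → A u v *ℝ f v)
      ≈⟨ *-congˡ (eigen u) ⟩
    1/√d u *ℝ (μ *ℝ ∑ (A u) *ℝ f u)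
      ≈⟨ *-congˡ (*-congʳ (*-congˡ (≈-trans (∑-indicator (adj G u)) (≈-sym (√-square (degree G u)))))) ⟩
    1/√d u *ℝ (μ *ℝ (√d u *ℝ √d u) *ℝ f u)
      ≈⟨ solve 4 (λ y m s f → y :* (m :* (s :* s) :* f) := s :* y :* (m :* (s :* f))) ≈-refl
           (1/√d u) μ (√d u) (f u) ⟩
    √d u *ℝ 1/√d u *ℝ (μ *ℝ (√d u *ℝ f u))
      ≈⟨ ≈-trans (*-congʳ (√d-inverse u)) (*ℝ-identityˡ _) ⟩
    μ *ℝ (√d u *ℝ f u) ∎

  scaled-combination : ∀ (f : Fin N → Vector ℝ N) (c : Vector ℝ N) i →
    ∑ (λ k → c k *ℝ (√d i *ℝ f k i)) ≈ √d i *ℝ ∑ (λ k → c k *ℝ f k i)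
  scaled-combination f c i = ≈-trans
    (∑-cong (λ k → solve 3 (λ c s f → c :* (s :* f) := s :* (c :* f)) ≈-refl (c k) (√d i) (f k i)))
    (≈-sym (*-distribˡ-sum (√d i) (λ k → c k *ℝ f k i)))

  -- D^½ is diagonal and invertible, so coefficients carry over unchanged; to span w, expand D^-½ w.
  scaled-basis : ∀ {f : Fin N → Vector ℝ N} → IsBasis f → IsBasis (λ k v → √d v *ℝ f k v)
  scaled-basis {f} basis = record
    { independent = λ c zeros → IsBasis.independent basis c λ i → un≈ (begin
        ∑ (λ k → c k *ℝ f k i)                             ≈⟨ *ℝ-identityˡ _ ⟨
        1ℝ *ℝ ∑ (λ k → c k *ℝ f k i)                       ≈⟨ *-congʳ (√d-inverse i) ⟨
        √d i *ℝ 1/√d i *ℝ ∑ (λ k → c k *ℝ f k i)           ≈⟨ solve 3 (λ s y x → s :* y :* x := y :* (s :* x)) ≈-refl _ _ _ ⟩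
        1/√d i *ℝ (√d i *ℝ ∑ (λ k → c k *ℝ f k i))         ≈⟨ *-congˡ (scaled-combination f c i) ⟨
        1/√d i *ℝ ∑ (λ k → c k *ℝ (√d i *ℝ f k i))         ≈⟨ *-congˡ (mk≈ (zeros i)) ⟩
        1/√d i *ℝ 0ℝ                                       ≈⟨ *ℝ-zeroʳ _ ⟩
        0ℝ                                                 ∎)
    ; spanning = λ w →
        let c , eq = IsBasis.spanning basis (λ i → 1/√d i *ℝ w i) in
        c , λ i → un≈ (begin
          w i                                    ≈⟨ *ℝ-identityˡ _ ⟨
          1ℝ *ℝ w i                              ≈⟨ *-congʳ (√d-inverse i) ⟨
          √d i *ℝ 1/√d i *ℝ w i                  ≈⟨ *ℝ-assoc _ _ _ ⟩
          √d i *ℝ (1/√d i *ℝ w i)                ≈⟨ *-congˡ (mk≈ (eq i)) ⟩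
          √d i *ℝ ∑ (λ k → c k *ℝ f k i)         ≈⟨ scaled-combination f c i ⟨
          ∑ (λ k → c k *ℝ (√d i *ℝ f k i))       ∎)
    }

  walkSpectrum : (μ : Fin N → ℝ) (f : Fin N → Vector ℝ N) →
    (∀ {i j} → i Fin.≤ j → μ j ≤ℝ μ i) →
    (∀ k u → ∑ (λ v → A u v *ℝ f k v) ≈ μ k *ℝ ∑ (A u) *ℝ f k u) →
    IsBasis f → Spectrum (normalizedAdjacency G deg≢0)
  walkSpectrum μ f decreasing eigen basis = record
    { eigenvalue  = μ
    ; eigenvector = λ k v → √d v *ℝ f k v
    ; decreasing  = decreasing
    ; isEigen     = λ k i → un≈ (scaled-eigenvector (μ k) (f k) (eigen k) i)
    ; isBasis     = scaled-basis basis
    }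

-- Vectors with an appended last entry, and naturals as reals

snoc : ∀ {a} {X : Set a} {k} → Vector X k → X → Vector X (suc k)
snoc {k = zero}  g x _       = x
snoc {k = suc k} g x zero    = g zero
snoc {k = suc k} g x (suc i) = snoc (λ j → g (suc j)) x i

snoc-fromℕ : ∀ {a} {X : Set a} {k} (g : Vector X k) x → snoc g x (fromℕ k) ≡ x
snoc-fromℕ {k = zero}  g x = refl
snoc-fromℕ {k = suc k} g x = snoc-fromℕ (λ j → g (suc j)) x

snoc-inject₁ : ∀ {a} {X : Set a} {k} (g : Vector X k) x i → snoc g x (inject₁ i) ≡ g i
snoc-inject₁ g x zero    = refl
snoc-inject₁ g x (suc i) = snoc-inject₁ (λ j → g (suc j)) x i

snoc-all : ∀ {a p} {X : Set a} (P : X → Set p) {k} {g : Vector X k} {x} →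
  (∀ i → P (g i)) → P x → ∀ j → P (snoc g x j)
snoc-all P {zero}  Pg Px j       = Px
snoc-all P {suc k} Pg Px zero    = Pg zero
snoc-all P {suc k} Pg Px (suc j) = snoc-all P (λ i → Pg (suc i)) Px j

top-elim : ∀ {p k} (P : Fin (suc k) → Set p) → P (fromℕ k) → (∀ i → P (inject₁ i)) → ∀ j → P j
top-elim P p q j with view j
... | ‵fromℕ     = p
... | ‵inject₁ i = q i

∑-snoc : ∀ {k} (g : Vector ℝ k) x → ∑ (snoc g x) ≈ ∑ g +ℝ x
∑-snoc {k} g x = ≈-trans (sum-init-last (snoc g x))
  (+-cong (∑-cong λ i → ≡⇒≈ (snoc-inject₁ g x i)) (≡⇒≈ (snoc-fromℕ g x)))

ι : ℕ → ℝ
ι n = fromℚ ⟦ n ⟧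

ι-+ : ∀ m n → ι (m ℕ.+ n) ≈ ι m +ℝ ι n
ι-+ m n = subst (λ q → fromℚ q ≈ ι m +ℝ ι n) (sym (frac-+ m n 0)) (fromℚ-+ ⟦ m ⟧ ⟦ n ⟧)

ι-* : ∀ m n → ι (m ℕ.* n) ≈ ι m *ℝ ι n
ι-* m n = subst (λ q → fromℚ q ≈ ι m *ℝ ι n) (sym (⟦⟧-* m n)) (fromℚ-* ⟦ m ⟧ ⟦ n ⟧)

ι-inverse : ∀ n → fromℚ (frac 1 n) *ℝ ι (suc n) ≈ 1ℝ
ι-inverse n = ≈-trans (≈-sym (fromℚ-* (frac 1 n) ⟦ suc n ⟧))
  (subst (λ q → fromℚ q ≈ 1ℝ) (sym (frac-inverse n)) ≈-refl)

∑-const : ∀ n x → ∑ {n} (λ _ → x) ≈ ι n *ℝ x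
∑-const zero    x = ≈-sym (*ℝ-zeroˡ x)
∑-const (suc n) x = begin
  x +ℝ ∑ {n} (λ _ → x)     ≈⟨ +-congˡ (∑-const n x) ⟩
  x +ℝ ι n *ℝ x            ≈⟨ solve 2 (λ x n → x :+ n :* x := (con 1ℚ :+ n) :* x) ≈-refl x (ι n) ⟩
  (1ℝ +ℝ ι n) *ℝ x         ≈⟨ *-congʳ (ι-+ 1 n) ⟨
  ι (suc n) *ℝ x           ∎
  where
  open ≈-Reasoning
  open ℝ-Solver using (solve; _:=_; _:+_; _:*_; :-_; _:-_; con)

-- The ring solver knows no relations between atoms; chained uses supply the
-- cofactor p of each relation u ≈ v, leaving an identity it can check.
modulo : ∀ {u v x y} → u ≈ v → ∀ p → x ≈ y +ℝ p *ℝ (u +ℝ -ℝ v) → x ≈ y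
modulo {u} {v} {x} {y} u≈v p eq = begin
  x                           ≈⟨ eq ⟩
  y +ℝ p *ℝ (u +ℝ -ℝ v)       ≈⟨ +-congˡ (*-congˡ (+-congʳ u≈v)) ⟩
  y +ℝ p *ℝ (v +ℝ -ℝ v)       ≈⟨ solve 3 (λ y p v → y :+ p :* (v :- v) := y) ≈-refl y p v ⟩
  y                           ∎
  where
  open ≈-Reasoning
  open ℝ-Solver using (solve; _:=_; _:+_; _:*_; :-_; _:-_; con)

-- The graph and its random walk

pattern apex     = zero
pattern pendant₁ = suc zero
pattern pendant₂ = suc (suc zero)
pattern clique i = suc (suc (suc i))

module _ (r : ℕ) where
  pendantAdj : Fin (3 ℕ.+ r) → Fin (3 ℕ.+ r) → Bool
  pendantAdj apex       apex       = false
  pendantAdj apex       (suc _)    = true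
  pendantAdj (suc _)    apex       = true
  pendantAdj (clique i) (clique j) = not (does (i Fin.≟ j))
  pendantAdj (suc _)    (suc _)    = false

  pendantAdj-sym : ∀ u v → pendantAdj u v ≡ pendantAdj v u
  pendantAdj-sym apex       apex       = refl
  pendantAdj-sym apex       (suc v)    = refl
  pendantAdj-sym (suc u)    apex       = refl
  pendantAdj-sym pendant₁   pendant₁   = refl
  pendantAdj-sym pendant₁   pendant₂   = refl
  pendantAdj-sym pendant₁   (clique _) = refl
  pendantAdj-sym pendant₂   pendant₁   = refl
  pendantAdj-sym pendant₂   pendant₂   = refl
  pendantAdj-sym pendant₂   (clique _) = refl
  pendantAdj-sym (clique _) pendant₁   = refl
  pendantAdj-sym (clique _) pendant₂   = refl
  pendantAdj-sym (clique i) (clique j) with i Fin.≟ j | j Fin.≟ i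
  ... | yes _   | yes _   = refl
  ... | no _    | no _    = refl
  ... | yes i≡j | no j≢i  with () ← j≢i (sym i≡j)
  ... | no i≢j  | yes j≡i with () ← i≢j (sym j≡i)

  pendantAdj-irrefl : ∀ v → pendantAdj v v ≡ false
  pendantAdj-irrefl apex       = refl
  pendantAdj-irrefl pendant₁   = refl
  pendantAdj-irrefl pendant₂   = refl
  pendantAdj-irrefl (clique i) with i Fin.≟ i
  ... | yes _  = refl
  ... | no i≢i with () ← i≢i refl

  pendantGraph : Graph (3 ℕ.+ r)
  pendantGraph = record { adj = pendantAdj ; symmetric = pendantAdj-sym ; loopless = pendantAdj-irrefl }

  pendantGraph-noIsolated : NoIsolatedVertices pendantGraph
  pendantGraph-noIsolated apex       = _
  pendantGraph-noIsolated pendant₁   = _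
  pendantGraph-noIsolated pendant₂   = _
  pendantGraph-noIsolated (clique _) = _

  pendantGraph-noPerfectMatching : ¬ PerfectMatching pendantGraph
  pendantGraph-noPerfectMatching pm =
    case trans (sym (unique (matched pendant₁ only₁))) (unique (matched pendant₂ only₂)) of λ ()
    where
    open PerfectMatching pm
    only₁ : ∀ v → T (pendantAdj pendant₁ v) → v ≡ apex
    only₁ apex _ = refl
    only₁ pendant₁ ()
    only₁ pendant₂ ()
    only₁ (clique _) ()
    only₂ : ∀ v → T (pendantAdj pendant₂ v) → v ≡ apex
    only₂ apex _ = refl
    only₂ pendant₁ ()
    only₂ pendant₂ ()
    only₂ (clique _) ()
    matched : ∀ u → (∀ v → T (pendantAdj u v) → v ≡ apex) → T (adj M apex u)
    matched u only with cover u
    ... | v , uv , _ with refl ← only v (M⊆G u v uv) = subst T (symmetric M u apex) uv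
    unique : ∀ {u} → T (adj M apex u) → proj₁ (cover apex) ≡ u
    unique = proj₂ (proj₂ (cover apex))

  module _ (f : Vector ℝ (3 ℕ.+ r)) where
    open ℝ-Solver using (solve; _:=_; _:+_; _:*_; :-_; _:-_; con)

    private
      A : Matrix (3 ℕ.+ r)
      A = adjacencyMatrix pendantGraph
      f[clique] : Vector ℝ r
      f[clique] i = f (clique i)

    row-apex : ∑ (λ v → A apex v *ℝ f v) ≈ f pendant₁ +ℝ f pendant₂ +ℝ ∑ f[clique]
    row-apex = ≈-trans (+-congˡ (+-congˡ (+-congˡ (∑-cong λ i → *ℝ-identityˡ (f[clique] i)))))
      (solve 4 (λ x y z c → con 0ℚ :* x :+ (con 1ℚ :* y :+ (con 1ℚ :* z :+ c)) := y :+ z :+ c) ≈-refl _ _ _ _)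

    row-pendant₁ : ∑ (λ v → A pendant₁ v *ℝ f v) ≈ f apex
    row-pendant₁ = ≈-trans (+-congˡ (+-congˡ (+-congˡ (≈-sym (*-distribˡ-sum 0ℝ f[clique])))))
      (solve 4 (λ x y z c → con 1ℚ :* x :+ (con 0ℚ :* y :+ (con 0ℚ :* z :+ con 0ℚ :* c)) := x) ≈-refl _ _ _ _)

    row-pendant₂ : ∑ (λ v → A pendant₂ v *ℝ f v) ≈ f apex
    row-pendant₂ = ≈-trans (+-congˡ (+-congˡ (+-congˡ (≈-sym (*-distribˡ-sum 0ℝ f[clique])))))
      (solve 4 (λ x y z c → con 1ℚ :* x :+ (con 0ℚ :* y :+ (con 0ℚ :* z :+ con 0ℚ :* c)) := x) ≈-refl _ _ _ _)

    -- On the clique block A is the all-ones matrix minus the identity, whence the subtracted term.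
    row-clique : ∀ i → ∑ (λ v → A (clique i) v *ℝ f v) ≈ f apex +ℝ ∑ f[clique] +ℝ -ℝ f (clique i)
    row-clique i = ≈-trans (+-congˡ (+-congˡ (+-congˡ others)))
      (solve 5 (λ x y z c e → con 1ℚ :* x :+ (con 0ℚ :* y :+ (con 0ℚ :* z :+ (c :+ con (ℚ.- 1ℚ) :* e))) := x :+ c :- e)
        ≈-refl _ _ _ _ _)
      where
      off : ∀ b x → (if not b then 1ℝ else 0ℝ) *ℝ x ≈ x +ℝ fromℚ (ℚ.- 1ℚ) *ℝ (if b then x else 0ℝ)
      off true  x = solve 1 (λ x → con 0ℚ :* x := x :+ con (ℚ.- 1ℚ) :* x) ≈-refl x
      off false x = solve 1 (λ x → con 1ℚ :* x := x :+ con (ℚ.- 1ℚ) :* con 0ℚ) ≈-refl x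
      others : ∑ (λ j → A (clique i) (clique j) *ℝ f (clique j)) ≈ ∑ f[clique] +ℝ fromℚ (ℚ.- 1ℚ) *ℝ f (clique i)
      others = ≈-trans (∑-cong (λ j → off (does (i Fin.≟ j)) (f (clique j))))
        (≈-trans (∑-distrib-+ f[clique] _) (+-congˡ (≈-trans
          (≈-sym (*-distribˡ-sum (fromℚ (ℚ.- 1ℚ)) (λ j → if does (i Fin.≟ j) then f (clique j) else 0ℝ)))
          (*-congˡ (∑-≟ˡ i f[clique])))))

-- Explicit eigenvalues and eigenfunctions of the walk

2ℝ : ℝ
2ℝ = ι 2

module PendantSpectrum (k : ℕ) where
  open ℝ-Solver using (solve; _:=_; _:+_; _:*_; :-_; _:-_; con)

  -- The successor form makes 1/r available and lets k = r - 1 index the differences of clique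
  -- vertices.
  r : ℕ
  r = suc k
  R : ℝ
  R = ι r

  -- κ is the discriminant of r(r+2)x² + (r+2)x = 2(r-1), with roots a and b,
  -- h = 1/(2r(r+2)), s = 1/r, and vol is the sum of the degrees.
  hden κ vol : ℕ
  hden = r ℕ.* ((2 ℕ.+ r) ℕ.* 2)
  κ    = (2 ℕ.+ r) ℕ.* ((2 ℕ.+ r) ℕ.+ 8 ℕ.* (k ℕ.* r))
  vol  = (2 ℕ.+ r) ℕ.+ (2 ℕ.+ r ℕ.* r)

  h t t′ ν s a b β γ : ℝ
  h  = fromℚ (frac 1 (ℕ.pred hden))
  t  = √ κ
  t′ = 1/√ κ
  ν  = fromℚ (frac 1 (ℕ.pred vol))
  s  = h *ℝ (2ℝ *ℝ (2ℝ +ℝ R))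
  -- β is -b, and the chain 0 ≤ s ≤ β ≤ 1 puts the whole spectrum in order: 1, β - s, 0, -s, -β.
  β  = h *ℝ (t +ℝ (2ℝ +ℝ R))
  a  = β +ℝ -ℝ s
  b  = -ℝ β
  -- The reciprocal of a - b = 2ht = t/(r(r + 2)).
  γ  = R *ℝ (2ℝ +ℝ R) *ℝ t′

  h-inverse : h *ℝ (R *ℝ ((2ℝ +ℝ R) *ℝ 2ℝ)) ≈ 1ℝ
  h-inverse = ≈-trans (*-congˡ (≈-sym (≈-trans (ι-* r ((2 ℕ.+ r) ℕ.* 2))
    (*-congˡ (≈-trans (ι-* (2 ℕ.+ r) 2) (*-congʳ (ι-+ 2 r))))))) (ι-inverse (ℕ.pred hden))

  ν-inverse : ν *ℝ ((2ℝ +ℝ R) +ℝ (2ℝ +ℝ R *ℝ R)) ≈ 1ℝ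
  ν-inverse = ≈-trans (*-congˡ (≈-sym (≈-trans (ι-+ (2 ℕ.+ r) (2 ℕ.+ r ℕ.* r))
    (+-cong (ι-+ 2 r) (≈-trans (ι-+ 2 (r ℕ.* r)) (+-congˡ (ι-* r r))))))) (ι-inverse (ℕ.pred vol))

  t-square : t *ℝ t ≈ (2ℝ +ℝ R) *ℝ ((2ℝ +ℝ R) +ℝ ι 8 *ℝ ((R +ℝ -ℝ 1ℝ) *ℝ R))
  t-square = ≈-trans (√-square κ) (≈-trans (ι-* (2 ℕ.+ r) ((2 ℕ.+ r) ℕ.+ 8 ℕ.* (k ℕ.* r)))
    (*-cong (ι-+ 2 r) (≈-trans (ι-+ (2 ℕ.+ r) (8 ℕ.* (k ℕ.* r))) (+-cong (ι-+ 2 r)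
      (≈-trans (ι-* 8 (k ℕ.* r)) (*-congˡ (≈-trans (ι-* k r) (*-congʳ ιk))))))))
    where
    ιk : ι k ≈ R +ℝ -ℝ 1ℝ
    ιk = ≈-trans (solve 1 (λ x → x := con 1ℚ :+ x :- con 1ℚ) ≈-refl (ι k)) (+-congʳ (≈-sym (ι-+ 1 k)))

  s-inverse : s *ℝ R ≈ 1ℝ
  s-inverse = ≈-trans (solve 2 (λ h R → h :* (con ⟦ 2 ⟧ :* (con ⟦ 2 ⟧ :+ R)) :* R := h :* (R :* ((con ⟦ 2 ⟧ :+ R) :* con ⟦ 2 ⟧)))
    ≈-refl h R) h-inverse

  γ-inverse : γ *ℝ (a +ℝ -ℝ b) ≈ 1ℝ
  γ-inverse = modulo h-inverse (t *ℝ t′) (modulo (√-inverse κ) 1ℝ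
    (solve 4 (λ h R t u → let P = con ⟦ 2 ⟧ :+ R; B = h :* (t :+ P); S = h :* (con ⟦ 2 ⟧ :* P) in
       R :* P :* u :* (B :- S :- (:- B)) :=
       con 1ℚ :+ t :* u :* (h :* (R :* (P :* con ⟦ 2 ⟧)) :- con 1ℚ) :+ con 1ℚ :* (t :* u :- con 1ℚ))
     ≈-refl h R t t′))

  Quadratic : ℝ → Set
  Quadratic x = R *ℝ (2ℝ +ℝ R) *ℝ (x *ℝ x) +ℝ (2ℝ +ℝ R) *ℝ x ≈ 2ℝ *ℝ (R +ℝ -ℝ 1ℝ)

  -- Write P = r + 2 and K = κ. First t² becomes K. The relation 2rPh = 1 is then used twice, giving
  -- the two summands of its cofactor: it turns rPh² into h/2, and, once the terms in t cancel, it
  -- turns h(K - P²)/2 = 2(r - 1)(2rPh) into 2(r - 1). The other root differs by the sign of t.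
  quadratic-a : Quadratic a
  quadratic-a = modulo h-inverse
    (fromℚ ½ *ℝ h *ℝ ((2ℝ +ℝ R) *ℝ ((2ℝ +ℝ R) +ℝ ι 8 *ℝ ((R +ℝ -ℝ 1ℝ) *ℝ R)) +ℝ -ℝ (2ℝ *ℝ t *ℝ (2ℝ +ℝ R)) +ℝ (2ℝ +ℝ R) *ℝ (2ℝ +ℝ R))
      +ℝ 2ℝ *ℝ (R +ℝ -ℝ 1ℝ))
    (modulo t-square (R *ℝ (2ℝ +ℝ R) *ℝ (h *ℝ h))
    (solve 3 (λ h R t → let P = con ⟦ 2 ⟧ :+ R; B = h :* (t :+ P); S = h :* (con ⟦ 2 ⟧ :* P)
                            x = B :- S; K = P :* (P :+ con ⟦ 8 ⟧ :* ((R :- con 1ℚ) :* R)) in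
       R :* P :* (x :* x) :+ P :* x :=
       con ⟦ 2 ⟧ :* (R :- con 1ℚ)
         :+ (con ½ :* h :* (K :- con ⟦ 2 ⟧ :* t :* P :+ P :* P) :+ con ⟦ 2 ⟧ :* (R :- con 1ℚ))
           :* (h :* (R :* (P :* con ⟦ 2 ⟧)) :- con 1ℚ)
         :+ R :* P :* (h :* h) :* (t :* t :- K))
      ≈-refl h R t))

  quadratic-b : Quadratic b
  quadratic-b = modulo h-inverse
    (fromℚ ½ *ℝ h *ℝ ((2ℝ +ℝ R) *ℝ ((2ℝ +ℝ R) +ℝ ι 8 *ℝ ((R +ℝ -ℝ 1ℝ) *ℝ R)) +ℝ 2ℝ *ℝ t *ℝ (2ℝ +ℝ R) +ℝ (2ℝ +ℝ R) *ℝ (2ℝ +ℝ R))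
      +ℝ 2ℝ *ℝ (R +ℝ -ℝ 1ℝ))
    (modulo t-square (R *ℝ (2ℝ +ℝ R) *ℝ (h *ℝ h))
    (solve 3 (λ h R t → let P = con ⟦ 2 ⟧ :+ R; x = :- (h :* (t :+ P))
                            K = P :* (P :+ con ⟦ 8 ⟧ :* ((R :- con 1ℚ) :* R)) in
       R :* P :* (x :* x) :+ P :* x :=
       con ⟦ 2 ⟧ :* (R :- con 1ℚ)
         :+ (con ½ :* h :* (K :+ con ⟦ 2 ⟧ :* t :* P :+ P :* P) :+ con ⟦ 2 ⟧ :* (R :- con 1ℚ))
           :* (h :* (R :* (P :* con ⟦ 2 ⟧)) :- con 1ℚ)
         :+ R :* P :* (h :* h) :* (t :* t :- K))
      ≈-refl h R t))

  A : Matrix (3 ℕ.+ r)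
  A = adjacencyMatrix (pendantGraph r)

  IsWalkEigen : ℝ → Vector ℝ (3 ℕ.+ r) → Set
  IsWalkEigen μ f = ∀ u → ∑ (λ v → A u v *ℝ f v) ≈ μ *ℝ ∑ (A u) *ℝ f u

  ∑-ones : ∑ {r} (λ _ → 1ℝ) ≈ R
  ∑-ones = ≈-trans (∑-const r 1ℝ) (*ℝ-identityʳ R)

  ∑A : ∀ u {x} → ∑ (λ v → A u v *ℝ 1ℝ) ≈ x → ∑ (A u) ≈ x
  ∑A u eq = ≈-trans (∑-cong (λ v → ≈-sym (*ℝ-identityʳ (A u v)))) eq

  -- Evaluates rows and degrees once for all candidates, leaving scalar equations at the apex, the
  -- pendants and the clique vertices; σ stands for the clique sum in simplified form.
  orbits⇒walkEigen : ∀ {μ} {f : Vector ℝ (3 ℕ.+ r)} {σ} → ∑ (λ i → f (clique i)) ≈ σ →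
    f pendant₁ +ℝ f pendant₂ +ℝ σ ≈ μ *ℝ (2ℝ +ℝ R) *ℝ f apex →
    f apex ≈ μ *ℝ f pendant₁ → f apex ≈ μ *ℝ f pendant₂ →
    (∀ i → f apex +ℝ σ +ℝ -ℝ f (clique i) ≈ μ *ℝ R *ℝ f (clique i)) →
    IsWalkEigen μ f
  orbits⇒walkEigen {μ} {f} ∑≈σ eq _ _ _ apex = ≈-trans (row-apex r f) (≈-trans (+-congˡ ∑≈σ) (≈-trans eq
    (*-congʳ (*-congˡ (≈-sym (∑A apex (≈-trans (row-apex r (λ _ → 1ℝ)) (+-cong (≈-sym (fromℚ-+ 1ℚ 1ℚ)) ∑-ones))))))))
  orbits⇒walkEigen {μ} {f} _ _ eq _ _ pendant₁ = ≈-trans (row-pendant₁ r f) (≈-trans eq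
    (*-congʳ (≈-trans (≈-sym (*ℝ-identityʳ μ)) (*-congˡ (≈-sym (∑A pendant₁ (row-pendant₁ r (λ _ → 1ℝ))))))))
  orbits⇒walkEigen {μ} {f} _ _ _ eq _ pendant₂ = ≈-trans (row-pendant₂ r f) (≈-trans eq
    (*-congʳ (≈-trans (≈-sym (*ℝ-identityʳ μ)) (*-congˡ (≈-sym (∑A pendant₂ (row-pendant₂ r (λ _ → 1ℝ))))))))
  orbits⇒walkEigen {μ} {f} ∑≈σ _ _ _ eq (clique i) = ≈-trans (row-clique r f i) (≈-trans (+-congʳ (+-congˡ ∑≈σ)) (≈-trans (eq i)
    (*-congʳ (*-congˡ (≈-sym (∑A (clique i) (≈-trans (row-clique r (λ _ → 1ℝ) i)
      (≈-trans (+-congʳ (+-congˡ ∑-ones)) (solve 1 (λ x → con 1ℚ :+ x :- con 1ℚ := x) ≈-refl R)))))))))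

  orbitFunction : ℝ → ℝ → ℝ → Vector ℝ (3 ℕ.+ r)
  orbitFunction x y z apex       = x
  orbitFunction x y z pendant₁   = y
  orbitFunction x y z pendant₂   = y
  orbitFunction x y z (clique _) = z

  -- The value on the clique that makes the function (x, 1, 1, ρ x) orthogonal
  -- to the constants for the degree measure.
  ρ : ℝ → ℝ
  ρ x = -ℝ (s *ℝ s *ℝ ((2ℝ +ℝ R) *ℝ x +ℝ 2ℝ))

  pendantDifference : Vector ℝ (3 ℕ.+ r)
  pendantDifference apex       = 0ℝ
  pendantDifference pendant₁   = 1ℝ
  pendantDifference pendant₂   = -ℝ 1ℝ
  pendantDifference (clique _) = 0ℝ

  -- The last clique vertex is the common reference of all k differences, so their coefficients can
  -- be read off at the other clique vertices.
  cliqueDifference : Fin k → Vector ℝ (3 ℕ.+ r)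
  cliqueDifference j (clique i) = snoc (λ l → if does (l Fin.≟ j) then 1ℝ else 0ℝ) (-ℝ 1ℝ) i
  cliqueDifference j _          = 0ℝ

  constant-eigen : IsWalkEigen 1ℝ (orbitFunction 1ℝ 1ℝ 1ℝ)
  constant-eigen = orbits⇒walkEigen ∑-ones
    (solve 1 (λ R → con 1ℚ :+ con 1ℚ :+ R := con 1ℚ :* (con ⟦ 2 ⟧ :+ R) :* con 1ℚ) ≈-refl R)
    (≈-sym (*ℝ-identityʳ 1ℝ)) (≈-sym (*ℝ-identityʳ 1ℝ))
    (λ _ → solve 1 (λ R → con 1ℚ :+ R :- con 1ℚ := con 1ℚ :* R :* con 1ℚ) ≈-refl R)

  -- With 1 at the pendants and x at the apex the pendant equations are immediate. Inserting `ρ x`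
  -- makes the apex equation -s times the quadratic and the clique equation s² times it, up to sR =
  -- 1.
  quadratic-eigen : ∀ {x} → Quadratic x → IsWalkEigen x (orbitFunction x 1ℝ (ρ x))
  quadratic-eigen {x} quad = orbits⇒walkEigen (∑-const r (ρ x))
    (modulo quad (-ℝ s) (modulo s-inverse ((2ℝ +ℝ R) *ℝ (x *ℝ x) +ℝ -ℝ (s *ℝ ((2ℝ +ℝ R) *ℝ x +ℝ 2ℝ)) +ℝ -ℝ 2ℝ)
      (solve 3 (λ x R s → let P = con ⟦ 2 ⟧ :+ R; c = :- (s :* s :* (P :* x :+ con ⟦ 2 ⟧)) in
        con 1ℚ :+ con 1ℚ :+ R :* c :=
        x :* P :* x :+ :- s :* (R :* P :* (x :* x) :+ P :* x :- con ⟦ 2 ⟧ :* (R :- con 1ℚ))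
          :+ (P :* (x :* x) :- s :* (P :* x :+ con ⟦ 2 ⟧) :- con ⟦ 2 ⟧) :* (s :* R :- con 1ℚ)) ≈-refl x R s)))
    (≈-sym (*ℝ-identityʳ x)) (≈-sym (*ℝ-identityʳ x))
    (λ _ → modulo quad (s *ℝ s) (modulo s-inverse (-ℝ (x *ℝ (s *ℝ R +ℝ 1ℝ)))
      (solve 3 (λ x R s → let P = con ⟦ 2 ⟧ :+ R; c = :- (s :* s :* (P :* x :+ con ⟦ 2 ⟧)) in
        x :+ R :* c :- c :=
        x :* R :* c :+ s :* s :* (R :* P :* (x :* x) :+ P :* x :- con ⟦ 2 ⟧ :* (R :- con 1ℚ))
          :+ :- (x :* (s :* R :+ con 1ℚ)) :* (s :* R :- con 1ℚ)) ≈-refl x R s)))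

  pendantDifference-eigen : IsWalkEigen 0ℝ pendantDifference
  pendantDifference-eigen = orbits⇒walkEigen (sum-replicate-zero r)
    (solve 1 (λ R → con 1ℚ :- con 1ℚ :+ con 0ℚ := con 0ℚ :* (con ⟦ 2 ⟧ :+ R) :* con 0ℚ) ≈-refl R)
    (≈-sym (*ℝ-zeroˡ _)) (≈-sym (*ℝ-zeroˡ _))
    (λ _ → solve 1 (λ R → con 0ℚ :+ con 0ℚ :- con 0ℚ := con 0ℚ :* R :* con 0ℚ) ≈-refl R)

  cliqueDifference-eigen : ∀ j → IsWalkEigen (-ℝ s) (cliqueDifference j)
  cliqueDifference-eigen j = orbits⇒walkEigen
    (≈-trans (∑-snoc (λ l → if does (l Fin.≟ j) then 1ℝ else 0ℝ) (-ℝ 1ℝ)) (≈-trans (+-congʳ (∑-≟ʳ j (λ _ → 1ℝ)))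
      (solve 0 (con 1ℚ :- con 1ℚ := con 0ℚ) ≈-refl)))
    (solve 2 (λ R s → con 0ℚ :+ con 0ℚ :+ con 0ℚ := :- s :* (con ⟦ 2 ⟧ :+ R) :* con 0ℚ) ≈-refl R s)
    (≈-sym (*ℝ-zeroʳ _)) (≈-sym (*ℝ-zeroʳ _))
    (λ i → let y = cliqueDifference j (clique i) in modulo s-inverse y
      (solve 3 (λ R s y → con 0ℚ :+ con 0ℚ :- y := :- s :* R :* y :+ y :* (s :* R :- con 1ℚ)) ≈-refl R s y))

  cliquePair : Fin k → ℝ × Vector ℝ (3 ℕ.+ r)
  cliquePair i = -ℝ s , cliqueDifference i

  bPair : ℝ × Vector ℝ (3 ℕ.+ r)
  bPair = b , orbitFunction b 1ℝ (ρ b)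

  -- The order is the decreasing one, which puts a at index 1 and b at the last index, the two
  -- places that `σ₂` reads. Pairing value and function lets one `snoc` place b together with its
  -- eigenfunction.
  eigenpair : Fin (3 ℕ.+ r) → ℝ × Vector ℝ (3 ℕ.+ r)
  eigenpair zero                = 1ℝ , orbitFunction 1ℝ 1ℝ 1ℝ
  eigenpair (suc zero)          = a , orbitFunction a 1ℝ (ρ a)
  eigenpair (suc (suc zero))    = 0ℝ , pendantDifference
  eigenpair (suc (suc (suc j))) = snoc cliquePair bPair j

  eigenpair-eigen : ∀ i → IsWalkEigen (proj₁ (eigenpair i)) (proj₂ (eigenpair i))
  eigenpair-eigen zero                = constant-eigen
  eigenpair-eigen (suc zero)          = quadratic-eigen quadratic-a
  eigenpair-eigen (suc (suc zero))    = pendantDifference-eigen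
  eigenpair-eigen (suc (suc (suc j))) = snoc-all (λ p → IsWalkEigen (proj₁ p) (proj₂ p))
    cliqueDifference-eigen (quadratic-eigen quadratic-b) j

  -- The eigenfunctions form a basis

  module Combination (c : Vector ℝ (3 ℕ.+ r)) where
    c₀ c₁ c₂ c₃ : ℝ
    c₀ = c zero
    c₁ = c (suc zero)
    c₂ = c (suc (suc zero))
    c₃ = c (suc (suc (suc (fromℕ k))))
    c′ : Vector ℝ k
    c′ j = c (suc (suc (suc (inject₁ j))))

    combination : Vector ℝ (3 ℕ.+ r)
    combination i = ∑ (λ l → c l *ℝ proj₂ (eigenpair l) i)

    expand : ∀ i {x} → ∑ (λ j → c′ j *ℝ cliqueDifference j i) ≈ x →
      combination i ≈ c₀ *ℝ orbitFunction 1ℝ 1ℝ 1ℝ i +ℝ (c₁ *ℝ orbitFunction a 1ℝ (ρ a) i +ℝ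
        (c₂ *ℝ pendantDifference i +ℝ (x +ℝ c₃ *ℝ orbitFunction b 1ℝ (ρ b) i)))
    expand i eq = +-congˡ (+-congˡ (+-congˡ (≈-trans
      (sum-init-last (λ j → c (suc (suc (suc j))) *ℝ proj₂ (eigenpair (suc (suc (suc j)))) i))
      (+-cong (≈-trans (∑-cong λ j → *-congˡ (≡⇒≈ (cong (λ p → proj₂ {A = ℝ} {B = λ _ → Vector ℝ (3 ℕ.+ r)} p i)
                 (snoc-inject₁ cliquePair bPair j)))) eq)
              (*-congˡ (≡⇒≈ (cong (λ p → proj₂ {A = ℝ} {B = λ _ → Vector ℝ (3 ℕ.+ r)} p i)
                 (snoc-fromℕ cliquePair bPair))))))))

    ∑-zeros : ∑ (λ j → c′ j *ℝ 0ℝ) ≈ 0ℝ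
    ∑-zeros = ≈-trans (≈-sym (*-distribʳ-sum 0ℝ c′)) (*ℝ-zeroʳ (∑ c′))

    at-apex : combination apex ≈ c₀ +ℝ (c₁ *ℝ a +ℝ c₃ *ℝ b)
    at-apex = ≈-trans (expand apex ∑-zeros) (solve 6
      (λ x y z w a b → x :* con 1ℚ :+ (y :* a :+ (z :* con 0ℚ :+ (con 0ℚ :+ w :* b))) := x :+ (y :* a :+ w :* b))
      ≈-refl c₀ c₁ c₂ c₃ a b)

    at-pendant₁ : combination pendant₁ ≈ c₀ +ℝ (c₁ +ℝ c₃) +ℝ c₂
    at-pendant₁ = ≈-trans (expand pendant₁ ∑-zeros) (solve 4
      (λ x y z w → x :* con 1ℚ :+ (y :* con 1ℚ :+ (z :* con 1ℚ :+ (con 0ℚ :+ w :* con 1ℚ))) := x :+ (y :+ w) :+ z)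
      ≈-refl c₀ c₁ c₂ c₃)

    at-pendant₂ : combination pendant₂ ≈ c₀ +ℝ (c₁ +ℝ c₃) +ℝ -ℝ c₂
    at-pendant₂ = ≈-trans (expand pendant₂ ∑-zeros) (solve 4
      (λ x y z w → x :* con 1ℚ :+ (y :* con 1ℚ :+ (z :* :- con 1ℚ :+ (con 0ℚ :+ w :* con 1ℚ))) := x :+ (y :+ w) :- z)
      ≈-refl c₀ c₁ c₂ c₃)

    -- The average of the combination over the clique: the differences sum to zero there, and the
    -- other functions are constant on it.
    mean : ℝ
    mean = c₀ +ℝ (c₁ *ℝ ρ a +ℝ c₃ *ℝ ρ b)

    at-clique : ∀ i → combination (clique i) ≈ mean +ℝ snoc c′ (-ℝ ∑ c′) i
    at-clique i = ≈-trans (expand (clique i) (differences i)) (solve 7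
      (λ x y z w a b d → x :* con 1ℚ :+ (y :* a :+ (z :* con 0ℚ :+ (d :+ w :* b))) := x :+ (y :* a :+ w :* b) :+ d)
      ≈-refl c₀ c₁ c₂ c₃ (ρ a) (ρ b) (snoc c′ (-ℝ ∑ c′) i))
      where
      differences : ∀ i → ∑ (λ j → c′ j *ℝ cliqueDifference j (clique i)) ≈ snoc c′ (-ℝ ∑ c′) i
      differences i with view i
      ... | ‵fromℕ = begin
        ∑ (λ j → c′ j *ℝ cliqueDifference j (clique (fromℕ k)))
          ≈⟨ ∑-cong {k} (λ j → *-congˡ (≡⇒≈ (snoc-fromℕ (λ l → if does (l Fin.≟ j) then 1ℝ else 0ℝ) (-ℝ 1ℝ)))) ⟩
        ∑ (λ j → c′ j *ℝ -ℝ 1ℝ)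
          ≈⟨ *-distribʳ-sum (-ℝ 1ℝ) c′ ⟨
        ∑ c′ *ℝ -ℝ 1ℝ
          ≈⟨ solve 1 (λ x → x :* :- con 1ℚ := :- x) ≈-refl (∑ c′) ⟩
        -ℝ ∑ c′
          ≡⟨ snoc-fromℕ c′ (-ℝ ∑ c′) ⟨
        snoc c′ (-ℝ ∑ c′) (fromℕ k) ∎
        where open ≈-Reasoning
      ... | ‵inject₁ l = begin
        ∑ (λ j → c′ j *ℝ cliqueDifference j (clique (inject₁ l)))
          ≈⟨ ∑-cong {k} (λ j → *-congˡ (≡⇒≈ (snoc-inject₁ (λ l → if does (l Fin.≟ j) then 1ℝ else 0ℝ) (-ℝ 1ℝ) l))) ⟩
        ∑ (λ j → c′ j *ℝ (if does (l Fin.≟ j) then 1ℝ else 0ℝ))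
          ≈⟨ ∑-cong (λ j → if-*ʳ (does (l Fin.≟ j)) (c′ j) 1ℝ) ⟩
        ∑ (λ j → if does (l Fin.≟ j) then c′ j *ℝ 1ℝ else 0ℝ)
          ≈⟨ ∑-≟ˡ l (λ j → c′ j *ℝ 1ℝ) ⟩
        c′ l *ℝ 1ℝ
          ≈⟨ *ℝ-identityʳ (c′ l) ⟩
        c′ l
          ≡⟨ snoc-inject₁ c′ (-ℝ ∑ c′) l ⟨
        snoc c′ (-ℝ ∑ c′) (inject₁ l) ∎
        where open ≈-Reasoning

  -- Since `ρ` is affine, the clique value of the two orbit functions depends only on their apex
  -- value xa + yb and their pendant value x + y.
  ρ-combination : ∀ x y → x *ℝ ρ a +ℝ y *ℝ ρ b ≈ -ℝ (s *ℝ s *ℝ ((2ℝ +ℝ R) *ℝ (x *ℝ a +ℝ y *ℝ b) +ℝ 2ℝ *ℝ (x +ℝ y)))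
  ρ-combination x y = solve 6 (λ x y s P a b →
    x :* :- (s :* s :* (P :* a :+ con ⟦ 2 ⟧)) :+ y :* :- (s :* s :* (P :* b :+ con ⟦ 2 ⟧)) :=
    :- (s :* s :* (P :* (x :* a :+ y :* b) :+ con ⟦ 2 ⟧ :* (x :+ y)))) ≈-refl x y s (2ℝ +ℝ R) a b

  -- The pendant difference isolates c₂. Averaging over the clique reduces the rest to three orbit
  -- equations; their degree-weighted sum isolates c₀, and then a - b being invertible separates c₁
  -- from c₃. What remains on the clique is the coefficients of the differences.
  independent : ∀ c → (∀ i → Combination.combination c i ≈ 0ℝ) → ∀ l → c l ≈ 0ℝ
  independent c zeros = all
    where
    open Combination c
    U W : ℝ
    U = c₁ +ℝ c₃
    W = c₁ *ℝ a +ℝ c₃ *ℝ b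
    z-apex : c₀ +ℝ W ≈ 0ℝ
    z-apex = ≈-trans (≈-sym at-apex) (zeros apex)
    z-pendant₁ : c₀ +ℝ U +ℝ c₂ ≈ 0ℝ
    z-pendant₁ = ≈-trans (≈-sym at-pendant₁) (zeros pendant₁)
    z-pendant₂ : c₀ +ℝ U +ℝ -ℝ c₂ ≈ 0ℝ
    z-pendant₂ = ≈-trans (≈-sym at-pendant₂) (zeros pendant₂)
    z-clique : ∀ i → mean +ℝ snoc c′ (-ℝ ∑ c′) i ≈ 0ℝ
    z-clique i = ≈-trans (≈-sym (at-clique i)) (zeros (clique i))
    z-∑ : R *ℝ mean ≈ 0ℝ
    z-∑ = begin
      R *ℝ mean
        ≈⟨ solve 2 (λ x y → x := x :+ (y :- y)) ≈-refl (R *ℝ mean) (∑ c′) ⟩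
      R *ℝ mean +ℝ (∑ c′ +ℝ -ℝ ∑ c′)
        ≈⟨ +-cong (∑-const r mean) (∑-snoc c′ (-ℝ ∑ c′)) ⟨
      ∑ {r} (λ _ → mean) +ℝ ∑ (snoc c′ (-ℝ ∑ c′))
        ≈⟨ ∑-distrib-+ {r} (λ _ → mean) (snoc c′ (-ℝ ∑ c′)) ⟨
      ∑ (λ i → mean +ℝ snoc c′ (-ℝ ∑ c′) i)
        ≈⟨ ∑-cong z-clique ⟩
      ∑ {r} (λ _ → 0ℝ)
        ≈⟨ sum-replicate-zero r ⟩
      0ℝ ∎
      where open ≈-Reasoning
    mean≈0 : mean ≈ 0ℝ
    mean≈0 = modulo z-∑ s (modulo s-inverse (-ℝ mean) (solve 3 (λ m s R →
      m := con 0ℚ :+ s :* (R :* m :- con 0ℚ) :+ :- m :* (s :* R :- con 1ℚ)) ≈-refl mean s R))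
    z-mean : c₀ +ℝ -ℝ (s *ℝ s *ℝ ((2ℝ +ℝ R) *ℝ W +ℝ 2ℝ *ℝ U)) ≈ 0ℝ
    z-mean = ≈-trans (+-congˡ (≈-sym (ρ-combination c₁ c₃))) mean≈0
    c₂≈0 : c₂ ≈ 0ℝ
    c₂≈0 = modulo z-pendant₁ (fromℚ ½) (modulo z-pendant₂ (-ℝ fromℚ ½) (solve 2 (λ x y →
      x := con 0ℚ :+ con ½ :* (y :+ x :- con 0ℚ) :+ :- con ½ :* (y :- x :- con 0ℚ)) ≈-refl c₂ (c₀ +ℝ U)))
    z-pendants : c₀ +ℝ U ≈ 0ℝ
    z-pendants = modulo z-pendant₁ 1ℝ (modulo c₂≈0 (-ℝ 1ℝ) (solve 2 (λ x y →
      y := con 0ℚ :+ con 1ℚ :* (y :+ x :- con 0ℚ) :+ :- con 1ℚ :* (x :- con 0ℚ)) ≈-refl c₂ (c₀ +ℝ U)))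
    V : ℝ
    V = (2ℝ +ℝ R) *ℝ W +ℝ 2ℝ *ℝ U
    z-V : (2ℝ +ℝ R) *ℝ c₀ +ℝ 2ℝ *ℝ c₀ +ℝ V ≈ 0ℝ
    z-V = modulo z-apex (2ℝ +ℝ R) (modulo z-pendants 2ℝ (solve 4 (λ P c W U →
      P :* c :+ con ⟦ 2 ⟧ :* c :+ (P :* W :+ con ⟦ 2 ⟧ :* U) :=
      con 0ℚ :+ P :* (c :+ W :- con 0ℚ) :+ con ⟦ 2 ⟧ :* (c :+ U :- con 0ℚ)) ≈-refl (2ℝ +ℝ R) c₀ W U))
    R²c₀≈V : R *ℝ R *ℝ c₀ ≈ V
    R²c₀≈V = modulo z-mean (R *ℝ R) (modulo s-inverse (V *ℝ (s *ℝ R +ℝ 1ℝ)) (solve 4 (λ R s c V →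
      R :* R :* c := V :+ R :* R :* (c :- s :* s :* V :- con 0ℚ) :+ V :* (s :* R :+ con 1ℚ) :* (s :* R :- con 1ℚ))
      ≈-refl R s c₀ V))
    -- Adding the orbit equations weighted by total degree eliminates V and leaves vol times c₀,
    -- because the other two functions are orthogonal to the constants.
    c₀≈0 : c₀ ≈ 0ℝ
    c₀≈0 = modulo z-V ν (modulo R²c₀≈V ν (modulo ν-inverse (-ℝ c₀) (solve 5 (λ P n c V Q →
      c := con 0ℚ :+ n :* (P :* c :+ con ⟦ 2 ⟧ :* c :+ V :- con 0ℚ) :+ n :* (Q :* c :- V)
                  :+ :- c :* (n :* (P :+ (con ⟦ 2 ⟧ :+ Q)) :- con 1ℚ)) ≈-refl (2ℝ +ℝ R) ν c₀ V (R *ℝ R))))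
    cancel : ∀ {x y} → x ≈ 0ℝ → x +ℝ y ≈ 0ℝ → y ≈ 0ℝ
    cancel {x} {y} x≈0 x+y≈0 = ≈-trans (≈-sym (+ℝ-identityˡ y)) (≈-trans (+-congʳ (≈-sym x≈0)) x+y≈0)
    U≈0 : U ≈ 0ℝ
    U≈0 = cancel c₀≈0 z-pendants
    c₁≈0 : c₁ ≈ 0ℝ
    c₁≈0 = modulo (cancel c₀≈0 z-apex) γ (modulo U≈0 (-ℝ (γ *ℝ b)) (modulo γ-inverse (-ℝ c₁)
      (solve 5 (λ c d a b g →
        c := con 0ℚ :+ g :* (c :* a :+ d :* b :- con 0ℚ) :+ :- (g :* b) :* (c :+ d :- con 0ℚ)
                    :+ :- c :* (g :* (a :- b) :- con 1ℚ))
        ≈-refl c₁ c₃ a b γ)))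
    all : ∀ l → c l ≈ 0ℝ
    all zero             = c₀≈0
    all (suc zero)       = c₁≈0
    all (suc (suc zero)) = c₂≈0
    all (suc (suc (suc j))) = top-elim (λ j → c (suc (suc (suc j))) ≈ 0ℝ) (cancel c₁≈0 U≈0)
      (λ i → cancel mean≈0 (≈-trans (+-congˡ (≡⇒≈ (sym (snoc-inject₁ c′ (-ℝ ∑ c′) i)))) (z-clique (inject₁ i)))) j

  module Coefficients (w : Vector ℝ (3 ℕ.+ r)) where
    -- w₁ and M are the averages of w over the pendants and the clique. c₀ is the projection to the
    -- constants, the degree-weighted total T₀ over vol. c₁ and c₃ solve c₁ + c₃ = w₁ - c₀ and c₁a +
    -- c₃b = w₀ - c₀ by Cramer's rule, with γ the inverse determinant.
    w₀ w₁ M T₀ c₀ c₁ c₂ c₃ : ℝ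
    w₀ = w apex
    w₁ = fromℚ ½ *ℝ (w pendant₁ +ℝ w pendant₂)
    M  = s *ℝ ∑ (λ i → w (clique i))
    T₀ = (2ℝ +ℝ R) *ℝ w₀ +ℝ 2ℝ *ℝ w₁ +ℝ R *ℝ R *ℝ M
    c₀ = ν *ℝ T₀
    c₁ = γ *ℝ ((w₀ +ℝ -ℝ c₀) +ℝ -ℝ (b *ℝ (w₁ +ℝ -ℝ c₀)))
    c₂ = fromℚ ½ *ℝ (w pendant₁ +ℝ -ℝ w pendant₂)
    c₃ = γ *ℝ (a *ℝ (w₁ +ℝ -ℝ c₀) +ℝ -ℝ (w₀ +ℝ -ℝ c₀))

    deviation : Vector ℝ r
    deviation i = w (clique i) +ℝ -ℝ M

    c : Vector ℝ (3 ℕ.+ r)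
    c zero                = c₀
    c (suc zero)          = c₁
    c (suc (suc zero))    = c₂
    c (suc (suc (suc j))) = snoc (λ i → deviation (inject₁ i)) c₃ j

    module C = Combination c

    C-c₃ : C.c₃ ≈ c₃
    C-c₃ = ≡⇒≈ (snoc-fromℕ (λ i → deviation (inject₁ i)) c₃)

    C-c′ : ∀ i → C.c′ i ≈ deviation (inject₁ i)
    C-c′ i = ≡⇒≈ (snoc-inject₁ (λ i → deviation (inject₁ i)) c₃ i)

    apex-part : C.c₁ *ℝ a +ℝ C.c₃ *ℝ b ≈ w₀ +ℝ -ℝ c₀
    apex-part = ≈-trans (+-congˡ (*-congʳ C-c₃)) (modulo γ-inverse (w₀ +ℝ -ℝ c₀)
      (solve 5 (λ g a b X Y → g :* (X :- b :* Y) :* a :+ g :* (a :* Y :- X) :* b :=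
        X :+ X :* (g :* (a :- b) :- con 1ℚ)) ≈-refl γ a b (w₀ +ℝ -ℝ c₀) (w₁ +ℝ -ℝ c₀)))

    pendant-part : C.c₁ +ℝ C.c₃ ≈ w₁ +ℝ -ℝ c₀
    pendant-part = ≈-trans (+-congˡ C-c₃) (modulo γ-inverse (w₁ +ℝ -ℝ c₀)
      (solve 5 (λ g a b X Y → g :* (X :- b :* Y) :+ g :* (a :* Y :- X) :=
        Y :+ Y :* (g :* (a :- b) :- con 1ℚ)) ≈-refl γ a b (w₀ +ℝ -ℝ c₀) (w₁ +ℝ -ℝ c₀)))

    volume-c₀ : ((2ℝ +ℝ R) +ℝ (2ℝ +ℝ R *ℝ R)) *ℝ c₀ ≈ T₀
    volume-c₀ = modulo ν-inverse T₀ (solve 3 (λ v n T → v :* (n :* T) := T :+ T :* (n :* v :- con 1ℚ))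
      ≈-refl _ ν T₀)

    -- After removal of its constant part, w has degree-weighted total zero, so the apex and
    -- pendants balance the clique.
    balance : (2ℝ +ℝ R) *ℝ (w₀ +ℝ -ℝ c₀) +ℝ 2ℝ *ℝ (w₁ +ℝ -ℝ c₀) ≈ R *ℝ R *ℝ (c₀ +ℝ -ℝ M)
    balance = modulo volume-c₀ (-ℝ 1ℝ) (solve 6 (λ P x y Q M c →
      P :* (x :- c) :+ con ⟦ 2 ⟧ :* (y :- c) :=
      Q :* (c :- M) :+ :- con 1ℚ :* ((P :+ (con ⟦ 2 ⟧ :+ Q)) :* c :- (P :* x :+ con ⟦ 2 ⟧ :* y :+ Q :* M)))
      ≈-refl (2ℝ +ℝ R) w₀ w₁ (R *ℝ R) M c₀)

    -- No coefficient is left to fit the clique average. It comes out right because `balance` makes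
    -- the clique value imposed by `ρ` equal to M - c₀.
    mean≈M : C.mean ≈ M
    mean≈M = ≈-trans (+-congˡ (≈-trans (ρ-combination C.c₁ C.c₃)
      (neg-cong (*-congˡ (≈-trans (+-cong (*-congˡ apex-part) (*-congˡ pendant-part)) balance)))))
      (modulo s-inverse (-ℝ ((c₀ +ℝ -ℝ M) *ℝ (s *ℝ R +ℝ 1ℝ))) (solve 4 (λ R s M c →
        c :- s :* s :* (R :* R :* (c :- M)) :=
        M :+ :- ((c :- M) :* (s :* R :+ con 1ℚ)) :* (s :* R :- con 1ℚ)) ≈-refl R s M c₀))

    ∑-deviation : ∑ deviation ≈ 0ℝ
    ∑-deviation = begin
      ∑ deviation
        ≈⟨ ∑-distrib-+ {r} (λ i → w (clique i)) (λ _ → -ℝ M) ⟩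
      ∑ (λ i → w (clique i)) +ℝ ∑ {r} (λ _ → -ℝ M)
        ≈⟨ +-congˡ (∑-const r (-ℝ M)) ⟩
      ∑ (λ i → w (clique i)) +ℝ R *ℝ -ℝ M
        ≈⟨ modulo s-inverse (-ℝ ∑ (λ i → w (clique i))) (solve 3 (λ R s x →
             x :+ R :* :- (s :* x) := con 0ℚ :+ :- x :* (s :* R :- con 1ℚ)) ≈-refl R s (∑ (λ i → w (clique i)))) ⟩
      0ℝ ∎
      where open ≈-Reasoning

    -- At the last vertex the value is forced to be minus the sum of the others; it agrees because
    -- deviations from the average sum to zero.
    differences≈deviation : ∀ i → snoc C.c′ (-ℝ ∑ C.c′) i ≈ deviation i
    differences≈deviation = top-elim _ last
      (λ j → ≈-trans (≡⇒≈ (snoc-inject₁ C.c′ (-ℝ ∑ C.c′) j)) (C-c′ j))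
      where
      open ≈-Reasoning
      last : snoc C.c′ (-ℝ ∑ C.c′) (fromℕ k) ≈ deviation (fromℕ k)
      last = begin
        snoc C.c′ (-ℝ ∑ C.c′) (fromℕ k)
          ≡⟨ snoc-fromℕ C.c′ (-ℝ ∑ C.c′) ⟩
        -ℝ ∑ C.c′
          ≈⟨ neg-cong (∑-cong C-c′) ⟩
        -ℝ ∑ (λ j → deviation (inject₁ j))
          ≈⟨ modulo (≈-trans (≈-sym (sum-init-last deviation)) ∑-deviation) (-ℝ 1ℝ) (solve 2 (λ x y →
               :- x := y :+ :- con 1ℚ :* (x :+ y :- con 0ℚ)) ≈-refl _ (deviation (fromℕ k))) ⟩
        deviation (fromℕ k) ∎

    spans : ∀ i → w i ≈ C.combination i
    spans apex = ≈-sym (≈-trans C.at-apex (≈-trans (+-congˡ apex-part)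
      (solve 2 (λ x y → x :+ (y :- x) := y) ≈-refl c₀ w₀)))
    spans pendant₁ = ≈-sym (≈-trans C.at-pendant₁ (≈-trans (+-congʳ (+-congˡ pendant-part))
      (solve 3 (λ c x y → c :+ (con ½ :* (x :+ y) :- c) :+ con ½ :* (x :- y) := x)
        ≈-refl c₀ (w pendant₁) (w pendant₂))))
    spans pendant₂ = ≈-sym (≈-trans C.at-pendant₂ (≈-trans (+-congʳ (+-congˡ pendant-part))
      (solve 3 (λ c x y → c :+ (con ½ :* (x :+ y) :- c) :- con ½ :* (x :- y) := y)
        ≈-refl c₀ (w pendant₁) (w pendant₂))))
    spans (clique i) = ≈-sym (≈-trans (C.at-clique i) (≈-trans (+-cong mean≈M (differences≈deviation i))
      (solve 2 (λ x y → x :+ (y :- x) := y) ≈-refl M (w (clique i)))))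

  eigenbasis : IsBasis (λ l → proj₂ (eigenpair l))
  eigenbasis = record
    { independent = λ c zeros l → un≈ (independent c (λ i → mk≈ (zeros i)) l)
    ; spanning    = λ w → Coefficients.c w , λ i → un≈ (Coefficients.spans w i)
    }

-- The order of the eigenvalues

-- The d of the theorem is suc d here.
module Bounds (k d : ℕ) (large : 8 ℕ.* (suc d ℕ.* suc d) ℕ.≤ suc k) where
  open PendantSpectrum k

  -- √κ and r + 2 are both at most numerator / (d + 1), which is 1 / (2h(d + 1)).
  numerator : ℕ
  numerator = (2 ℕ.+ r) ℕ.* r

  κ-lower : (2 ℕ.+ r) ℕ.* (2 ℕ.+ r) ℕ.≤ κ
  κ-lower = ℕ.*-monoʳ-≤ (2 ℕ.+ r) (ℕ.m≤m+n (2 ℕ.+ r) (8 ℕ.* (k ℕ.* r)))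

  -- From r + 2 ≤ 8r follows κ ≤ 8(r + 2)r². The bound `large` absorbs this 8 together with the
  -- square of `suc d`, which is where its constant 8 comes from.
  κ-upper : κ ℕ.* (suc d ℕ.* suc d) ℕ.≤ numerator ℕ.* numerator
  κ-upper = begin
    (2 ℕ.+ r) ℕ.* ((2 ℕ.+ r) ℕ.+ 8 ℕ.* (k ℕ.* r)) ℕ.* (suc d ℕ.* suc d)
      ≤⟨ ℕ.*-monoˡ-≤ (suc d ℕ.* suc d) (ℕ.*-monoʳ-≤ (2 ℕ.+ r) lemma) ⟩
    (2 ℕ.+ r) ℕ.* (8 ℕ.* (r ℕ.* r)) ℕ.* (suc d ℕ.* suc d)
      ≡⟨ solve 3 (λ p q e → p :* (con 8 :* q) :* e := p :* (q :* (con 8 :* e))) refl (2 ℕ.+ r) (r ℕ.* r) (suc d ℕ.* suc d) ⟩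
    (2 ℕ.+ r) ℕ.* (r ℕ.* r ℕ.* (8 ℕ.* (suc d ℕ.* suc d)))
      ≤⟨ ℕ.*-monoʳ-≤ (2 ℕ.+ r) (ℕ.*-monoʳ-≤ (r ℕ.* r) (ℕ.≤-trans large (ℕ.m≤n+m r 2))) ⟩
    (2 ℕ.+ r) ℕ.* (r ℕ.* r ℕ.* (2 ℕ.+ r))
      ≡⟨ solve 2 (λ p q → p :* (q :* q :* p) := p :* q :* (p :* q)) refl (2 ℕ.+ r) r ⟩
    numerator ℕ.* numerator ∎
    where
    open ℕ.≤-Reasoning
    open ℕ.+-*-Solver using (solve; _:=_; _:+_; _:*_; con)
    lemma : (2 ℕ.+ r) ℕ.+ 8 ℕ.* (k ℕ.* r) ℕ.≤ 8 ℕ.* (r ℕ.* r)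
    lemma = subst ((2 ℕ.+ r) ℕ.+ 8 ℕ.* (k ℕ.* r) ℕ.≤_)
      (solve 1 (λ k → let r = con 1 :+ k in
        (con 2 :+ r) :+ con 8 :* (k :* r) :+ (con 5 :+ con 7 :* k) := con 8 :* (r :* r)) refl k)
      (ℕ.m≤m+n _ (5 ℕ.+ 7 ℕ.* k))

  numerator-large : (2 ℕ.+ r) ℕ.* suc d ℕ.≤ numerator
  numerator-large = ℕ.*-monoʳ-≤ (2 ℕ.+ r) (begin
    suc d                          ≤⟨ ℕ.m≤m*n (suc d) (suc d) ⟩
    suc d ℕ.* suc d                ≤⟨ ℕ.m≤n*m (suc d ℕ.* suc d) 8 ⟩
    8 ℕ.* (suc d ℕ.* suc d)        ≤⟨ large ⟩
    r                              ∎)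
    where open ℕ.≤-Reasoning

  double-numerator : 1 ℕ.* (numerator ℕ.+ numerator) ℕ.* suc d ≡ 1 ℕ.* (hden ℕ.* suc d)
  double-numerator = solve 2 (λ r e →
    con 1 :* ((con 2 :+ r) :* r :+ (con 2 :+ r) :* r) :* e := con 1 :* (r :* ((con 2 :+ r) :* con 2) :* e)) refl r (suc d)
    where open ℕ.+-*-Solver using (solve; _:=_; _:+_; _:*_; con)

  δ : ℝ
  δ = fromℚ (frac 1 d)

  hℚ : ℚ
  hℚ = frac 1 (ℕ.pred hden)

  instance
    hℚ-nonNeg : ℚ.NonNegative hℚ
    hℚ-nonNeg = ℚ.nonNegative (frac-nonNeg 1 (ℕ.pred hden))

  private
    2+r : ⟦ 2 ℕ.+ r ⟧ ≡ ⟦ 2 ⟧ ℚ.+ ⟦ r ⟧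
    2+r = frac-+ 2 r 0

  opaque
    unfolding _+ℝ_

    s-nonNeg : 0ℝ ⊑ s
    s-nonNeg = mk⊑ λ n → nonNeg-* (frac-nonNeg 1 (ℕ.pred hden))
      (nonNeg-* (frac-nonNeg 2 0) (ℚ.+-mono-≤ (frac-nonNeg 2 0) (frac-nonNeg r 0)))

    s⊑β : s ⊑ β
    s⊑β = mk⊑ λ n → ℚ.*-monoˡ-≤-nonNeg hℚ (begin
      ⟦ 2 ⟧ ℚ.* (⟦ 2 ⟧ ℚ.+ ⟦ r ⟧)
        ≡⟨ solve 1 (λ x → con ⟦ 2 ⟧ :* x := x :+ x) refl (⟦ 2 ⟧ ℚ.+ ⟦ r ⟧) ⟩
      (⟦ 2 ⟧ ℚ.+ ⟦ r ⟧) ℚ.+ (⟦ 2 ⟧ ℚ.+ ⟦ r ⟧)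
        ≤⟨ ℚ.+-monoˡ-≤ (⟦ 2 ⟧ ℚ.+ ⟦ r ⟧) (subst (ℚ._≤ seq t n) 2+r (√-lower κ {2 ℕ.+ r} κ-lower n)) ⟩
      seq t n ℚ.+ (⟦ 2 ⟧ ℚ.+ ⟦ r ⟧) ∎)
      where
      open ℚ.≤-Reasoning
      open ℚ.+-*-Solver using (solve; _:=_; _:+_; _:*_; con)

    β⊑δ : β ⊑ δ
    β⊑δ = mk⊑ λ n → begin
      hℚ ℚ.* (seq t n ℚ.+ (⟦ 2 ⟧ ℚ.+ ⟦ r ⟧))
        ≤⟨ ℚ.*-monoˡ-≤-nonNeg hℚ (ℚ.+-mono-≤ (√-upper κ {numerator} {d} κ-upper n)
             (subst (ℚ._≤ frac numerator d) 2+r (frac-≤ {2 ℕ.+ r} {0} {numerator} {d}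
               (subst ((2 ℕ.+ r) ℕ.* suc d ℕ.≤_) (sym (ℕ.*-identityʳ numerator)) numerator-large)))) ⟩
      hℚ ℚ.* (frac numerator d ℚ.+ frac numerator d)
        ≡⟨ cong (hℚ ℚ.*_) (frac-+ numerator numerator d) ⟨
      hℚ ℚ.* frac (numerator ℕ.+ numerator) d
        ≡⟨ frac-* 1 (ℕ.pred hden) (numerator ℕ.+ numerator) d ⟩
      frac (1 ℕ.* (numerator ℕ.+ numerator)) (d ℕ.+ ℕ.pred hden ℕ.* suc d)
        ≤⟨ frac-≤ {1 ℕ.* (numerator ℕ.+ numerator)} {d ℕ.+ ℕ.pred hden ℕ.* suc d} {1} {d} (ℕ.≤-reflexive double-numerator) ⟩
      frac 1 d ∎
      where
      open ℚ.≤-Reasoning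

    a-nonNeg : 0ℝ ⊑ a
    a-nonNeg = mk⊑ λ n → subst (ℚ._≤ seq β n ℚ.- seq s n) (ℚ.+-inverseʳ (seq s n)) (ℚ.+-monoˡ-≤ (ℚ.- seq s n) (un⊑ s⊑β n))

    a⊑β : a ⊑ β
    a⊑β = mk⊑ λ n → subst (seq β n ℚ.- seq s n ℚ.≤_) (ℚ.+-identityʳ (seq β n)) (ℚ.+-monoʳ-≤ (seq β n) (ℚ.neg-antimono-≤ (un⊑ s-nonNeg n)))

    -s⊑0 : -ℝ s ⊑ 0ℝ
    -s⊑0 = mk⊑ λ n → ℚ.neg-antimono-≤ (un⊑ s-nonNeg n)

    b⊑-s : b ⊑ -ℝ s
    b⊑-s = mk⊑ λ n → ℚ.neg-antimono-≤ (un⊑ s⊑β n)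

    -b⊑β : -ℝ b ⊑ β
    -b⊑β = mk⊑ λ n → ℚ.≤-reflexive (solve 1 (λ x → :- (:- x) := x) refl (seq β n))
      where open ℚ.+-*-Solver using (solve; _:=_; :-_)

  δ⊑1 : δ ⊑ 1ℝ
  δ⊑1 = mk⊑ λ n → frac-≤ {1} {d} {1} {0} (ℕ.*-monoʳ-≤ 1 (s≤s (z≤n {d})))

  μ : Fin (3 ℕ.+ r) → ℝ
  μ i = proj₁ (eigenpair i)

  tail⊑-s : ∀ j → μ (suc (suc (suc j))) ⊑ -ℝ s
  tail⊑-s = snoc-all (λ p → proj₁ p ⊑ -ℝ s) (λ _ → ⊑-refl) b⊑-s

  -- If i is the last index then j equals i; otherwise the value at i is -s, an upper bound for the
  -- whole tail.
  tail-decreasing : ∀ {i j} → i Fin.≤ j → μ (suc (suc (suc j))) ⊑ μ (suc (suc (suc i)))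
  tail-decreasing {i} {j} = top-elim (λ i → i Fin.≤ j → μ (suc (suc (suc j))) ⊑ μ (suc (suc (suc i))))
    (λ last≤j → subst (λ j → μ (suc (suc (suc j))) ⊑ μ (suc (suc (suc (fromℕ k)))))
      (Fin.≤-antisym last≤j (Fin.≤fromℕ j)) ⊑-refl)
    (λ l _ → subst (λ p → μ (suc (suc (suc j))) ⊑ proj₁ p) (sym (snoc-inject₁ cliquePair bPair l)) (tail⊑-s j))
    i

  ⊑0 : ∀ j → μ (suc (suc j)) ⊑ 0ℝ
  ⊑0 zero    = ⊑-refl
  ⊑0 (suc j) = ⊑-trans (tail⊑-s j) -s⊑0

  ⊑a : ∀ j → μ (suc j) ⊑ a
  ⊑a zero    = ⊑-refl
  ⊑a (suc j) = ⊑-trans (⊑0 j) a-nonNeg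

  ⊑1 : ∀ j → μ j ⊑ 1ℝ
  ⊑1 zero    = ⊑-refl
  ⊑1 (suc j) = ⊑-trans (⊑a j) (⊑-trans a⊑β (⊑-trans β⊑δ δ⊑1))

  μ-decreasing : ∀ {i j} → i Fin.≤ j → μ j ⊑ μ i
  μ-decreasing {zero}              {j}                 _                     = ⊑1 j
  μ-decreasing {suc zero}          {suc j}             _                     = ⊑a j
  μ-decreasing {suc (suc zero)}    {suc (suc j)}       _                     = ⊑0 j
  μ-decreasing {suc (suc zero)}    {suc zero}          (s≤s ())
  μ-decreasing {suc (suc (suc i))} {suc (suc (suc j))} (s≤s (s≤s (s≤s i≤j))) = tail-decreasing i≤j

  pendantSpectrum : Spectrum (normalizedAdjacency (pendantGraph r) (pendantGraph-noIsolated r))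
  pendantSpectrum = walkSpectrum (pendantGraph r) (pendantGraph-noIsolated r)
    μ (λ i → proj₂ (eigenpair i)) (λ i≤j → ⊑⇒≤ (μ-decreasing i≤j)) eigenpair-eigen eigenbasis

  opaque
    unfolding _+ℝ_ _⊔ℝ_

    -- `∣ b ∣ℝ` is max(b, -b), so three bounds are needed: a ≤ β and -b ≤ β with β ≤ δ, and b ≤ 0.
    σ₂-bound : ∀ {ε} → δ ⊑ ε → σ₂ (s≤s (s≤s z≤n)) pendantSpectrum ⊑ ε
    σ₂-bound {ε} δ⊑ε = subst (λ x → a ⊔ℝ ∣ x ∣ℝ ⊑ ε) (sym (cong proj₁ (snoc-fromℕ cliquePair bPair)))
      (mk⊑ λ n → ℚ.⊔-lub (un⊑ (⊑-trans (⊑-trans a⊑β β⊑δ) δ⊑ε) n) (ℚ.⊔-lub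
        (un⊑ (⊑-trans (⊑-trans b⊑-s (⊑-trans -s⊑0 (mk⊑ λ _ → frac-nonNeg 1 d))) δ⊑ε) n)
        (un⊑ (⊑-trans (⊑-trans -b⊑β β⊑δ) δ⊑ε) n)))

  pendantGraph-expander : ∀ {ε} → δ ⊑ ε → IsSpectralExpander (pendantGraph r) ε
  pendantGraph-expander δ⊑ε = record
    { 2≤N        = s≤s (s≤s z≤n)
    ; noIsolated = pendantGraph-noIsolated r
    ; spectrum   = pendantSpectrum
    ; σ₂≤ε       = ⊑⇒≤ (σ₂-bound δ⊑ε)
    }

-- Comparison of 1/d with 1/√d, and the choice of n₀

opaque
  unfolding _+ℝ_

  frac⊑1/√ : ∀ d → fromℚ (frac 1 d) ⊑ 1ℝ *ℝ 1/√ suc d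
  frac⊑1/√ d = mk⊑ λ n → subst (frac 1 d ℚ.≤_) (sym (ℚ.*-identityˡ _)) (1/√-lower d n)

theorem1p5 : Σ[ C ∈ ℝ ] (0ℝ <ℝ C ×
    ((d : ℕ) → (d≥3 : d ≥ 3) →
    Σ[ n₀ ∈ ℕ ] (n₀ > 0 ×
    ((n : ℕ) → n ≥ n₀ →
    Σ[ G ∈ Graph (2 * n) ]
    (IsSpectralExpander G (C *ℝ (1/√ d) {{3≤⇒NonZero d≥3}}) × ¬ PerfectMatching G)))))
theorem1p5 = 1ℝ , (1ℚ , 0<1ℚ , 0 , λ _ _ → ℚ.≤-refl) , construction
  where
  construction : (d : ℕ) → (d≥3 : d ≥ 3) → Σ[ n₀ ∈ ℕ ] (n₀ > 0 × ((n : ℕ) → n ≥ n₀ →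
    Σ[ G ∈ Graph (2 * n) ] (IsSpectralExpander G (1ℝ *ℝ (1/√ d) {{3≤⇒NonZero d≥3}}) × ¬ PerfectMatching G)))
  -- With k = 2n - 4 and r = k + 1 the graph has 3 + r = 2n vertices. The summand 4 makes the
  -- truncated subtraction exact, and 8d² then gives 8d² ≤ k, hence the bound `large` on r.
  construction (suc d) (s≤s _) = 8 * (suc d * suc d) ℕ.+ 4 , s≤s z≤n , λ n n≥n₀ →
    let 8d²+4≤2n = ℕ.≤-trans n≥n₀ (ℕ.m≤m+n n (1 * n))
        k = 2 * n ℕ.∸ 4
        large = ℕ.m≤n⇒m≤1+n (ℕ.m+n≤o⇒m≤o∸n (8 * (suc d * suc d)) 8d²+4≤2n)
    in subst (λ N → Σ[ G ∈ Graph N ] (IsSpectralExpander G (1ℝ *ℝ 1/√ suc d) × ¬ PerfectMatching G))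
         (ℕ.m+[n∸m]≡n (ℕ.≤-trans (ℕ.m≤n+m 4 (8 * (suc d * suc d))) 8d²+4≤2n))
         (pendantGraph (suc k) , Bounds.pendantGraph-expander k d large (frac⊑1/√ d)
         , pendantGraph-noPerfectMatching (suc k))
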